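{- The maximal unbordered factor of a string of length $n$ over an alphabet $A$ of size $\sigma$ can be found in $\mathcal{O}\bigl(\frac{n^2}{\sigma^4}\bigr)$ expected time. That is, there are a deterministic algorithm which, given any string $S$ over $A$, correctly outputs a maximal unbordered factor of $S$, and an absolute constant $C$ such that for each $\sigma$ and all sufficiently large $n$ (depending on $\sigma$), the average of its running time over all $\sigma^n$ strings $S\in A^n$ is at most $C\,\frac{n^2}{\sigma^4}$.
   Context: $A^n$ is the set of all strings of length $n$ over the finite alphabet $A$; "expected time" means the running time averaged over the uniform distribution on input strings in $A^n$. Running time is the number of elementary operations (letter comparisons, arithmetic on and storage of integers of size at most $n$, array accesses) in the standard unit-cost RAM model. A factor of a string $S=S[1]\cdots S[n]$ is a contiguous substring $S[i..j]=S[i]\cdots S[j]$, $1\le i\le j\le n$. A prefix or suffix of $S$ is proper if it is non-empty and different from $S$. A border of a string is a proper prefix of it that is simultaneously a suffix of it. A string is unbordered if it has no border (in particular every string of length 1 is unbordered). The maximal unbordered factor of $S$ is a longest factor of $S$ that is unbordered. -}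

module Defs where

open import Data.Bool.Base using (Bool; if_then_else_)
open import Data.Fin.Base using (Fin; toℕ)
open import Data.Integer.Base using (+_)
open import Data.List.Base using (List; []; _∷_; take; drop; head; length; map; allFin; cartesianProductWith)
open import Data.List.Relation.Binary.Prefix.Heterogeneous using (Prefix)
open import Data.List.Relation.Binary.Suffix.Heterogeneous using (Suffix)
open import Data.Maybe.Base using (Maybe; just; nothing)
open import Data.Nat.Base using (ℕ; zero; suc; _+_; _∸_; _*_; _^_; _/_; _≤_; _≤ᵇ_; _<ᵇ_; _≡ᵇ_; NonZero)
open import Data.Nat.ListAction using (sum)
open import Data.Nat.Properties using (m^n≢0)
open import Data.Product.Base using (∃; _×_)
open import Data.Rational.Unnormalised.Base using (ℚᵘ) renaming (_/_ to _/ℚ_)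
open import Data.Vec.Base using (Vec; []; _∷_; toList)
open import Relation.Binary.PropositionalEquality.Core using (_≡_; _≢_)
open import Relation.Nullary.Negation.Core using (¬_)

FactorBounds : ℕ → ℕ → ℕ → Set
FactorBounds n i j = 1 ≤ i × i ≤ j × j ≤ n

module _ {A : Set} where

  ProperPrefix : List A → List A → Set
  ProperPrefix u w = u ≢ [] × u ≢ w × Prefix _≡_ u w

  Border : List A → List A → Set
  Border u w = ProperPrefix u w × Suffix _≡_ u w

  Unbordered : List A → Set
  Unbordered w = ¬ ∃ λ u → Border u w

  -- Positions are numbered from 1, so S ⟦ i ‥ j ⟧ is S[i]⋯S[j]; meaningful only for
  -- 1 ≤ i ≤ j ≤ n.
  _⟦_‥_⟧ : ∀ {n} → Vec A n → ℕ → ℕ → List A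
  S ⟦ i ‥ j ⟧ = take (suc j ∸ i) (drop (i ∸ 1) (toList S))

  IsMaximalUnborderedFactor : ∀ {n} → Vec A n → ℕ → ℕ → Set
  IsMaximalUnborderedFactor {n} S i j =
    FactorBounds n i j ×
    Unbordered (S ⟦ i ‥ j ⟧) ×
    (∀ i′ j′ → FactorBounds n i′ j′ → Unbordered (S ⟦ i′ ‥ j′ ⟧) →
      length (S ⟦ i′ ‥ j′ ⟧) ≤ length (S ⟦ i ‥ j ⟧))

  letter : ∀ {n} → Vec A n → ℕ → Maybe A
  letter []      _             = nothing
  letter (x ∷ S) zero          = nothing
  letter (x ∷ S) (suc zero)    = just x
  letter (x ∷ S) (suc (suc k)) = letter S (suc k)

-- A unit-cost RAM.  A program is a finite list of instructions; it mentions finitely many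
-- integer registers and finitely many integer arrays, both named by natural numbers.  The
-- input string is read-only and its letters can only be compared.  Jump targets are
-- absolute, counted from 0.

Reg Arr Label : Set
Reg   = ℕ
Arr   = ℕ
Label = ℕ

data Op : Set where
  add sub mul div : Op

data Cmp : Set where
  eq lt : Cmp

data Instr : Set where
  const  : Reg → ℕ → Instr                   -- r ← k
  len    : Reg → Instr                       -- r ← n
  move   : Reg → Reg → Instr                 -- r ← a
  arith  : Op → Reg → Reg → Reg → Instr      -- r ← a ∘ b
  load   : Reg → Arr → Reg → Instr           -- r ← M[a]
  store  : Arr → Reg → Reg → Instr           -- M[a] ← b
  jump   : Label → Instr                     -- goto ℓ
  jumpIf : Cmp → Reg → Reg → Label → Instr   -- if a ⋈ b goto ℓ
  jumpIfLetter : Cmp → Reg → Reg → Label → Instr   -- if S[a] ⋈ S[b] goto ℓ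
  return : Reg → Reg → Instr                 -- halt with output (a , b)

Program : Set
Program = List Instr

record Config : Set where
  constructor ⟨_,_,_⟩
  field
    pc   : ℕ
    regs : Reg → ℕ
    arrs : Arr → ℕ → ℕ

data Outcome : Set where
  running  : Config → Outcome
  returned : ℕ → ℕ → Outcome
  fault    : Outcome

-- Subtraction is truncated at 0; division by 0 is undefined.
evalOp : Op → ℕ → ℕ → Maybe ℕ
evalOp add x y       = just (x + y)
evalOp sub x y       = just (x ∸ y)
evalOp mul x y       = just (x * y)
evalOp div x zero    = nothing
evalOp div x (suc y) = just (x / suc y)

holds : Cmp → ℕ → ℕ → Bool
holds eq x y = x ≡ᵇ y
holds lt x y = x <ᵇ y

_[_↦_] : {B : Set} → (ℕ → B) → ℕ → B → ℕ → B
(f [ k ↦ v ]) m = if m ≡ᵇ k then v else f m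

module _ {σ n : ℕ} (S : Vec (Fin σ) n) where

  -- Only integers of size at most n can be stored: a larger result is a fault.  As array
  -- indices come from registers, only the cells 0, …, n of an array are ever accessed.
  assign : Config → Reg → ℕ → Outcome
  assign ⟨ pc , R , M ⟩ r v =
    if v ≤ᵇ n then running ⟨ suc pc , R [ r ↦ v ] , M ⟩ else fault

  branch : Config → Bool → Label → Outcome
  branch ⟨ pc , R , M ⟩ b ℓ = running ⟨ (if b then ℓ else suc pc) , R , M ⟩

  assign? : Config → Reg → Maybe ℕ → Outcome
  assign? c r (just v) = assign c r v
  assign? c r nothing  = fault

  branchLetter : Config → Cmp → Maybe (Fin σ) → Maybe (Fin σ) → Label → Outcome
  branchLetter c ⋈ (just x) (just y) ℓ = branch c (holds ⋈ (toℕ x) (toℕ y)) ℓ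
  branchLetter c ⋈ _        _        ℓ = fault

  exec : Instr → Config → Outcome
  exec (const r k)   c = assign c r k
  exec (len r)       c = assign c r n
  exec (move r a)    c = assign c r (Config.regs c a)
  exec (arith o r a b) c = assign? c r (evalOp o (Config.regs c a) (Config.regs c b))
  exec (load r m a)  c = assign c r (Config.arrs c m (Config.regs c a))
  exec (store m a b) ⟨ pc , R , M ⟩ = running ⟨ suc pc , R , M [ m ↦ M m [ R a ↦ R b ] ] ⟩
  exec (jump ℓ)      ⟨ pc , R , M ⟩ = running ⟨ ℓ , R , M ⟩
  exec (jumpIf ⋈ a b ℓ) c = branch c (holds ⋈ (Config.regs c a) (Config.regs c b)) ℓ
  exec (jumpIfLetter ⋈ a b ℓ) c =
    branchLetter c ⋈ (letter S (Config.regs c a)) (letter S (Config.regs c b)) ℓ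
  exec (return a b)  c = returned (Config.regs c a) (Config.regs c b)

  execAt : Maybe Instr → Config → Outcome
  execAt (just ι) c = exec ι c
  execAt nothing  c = fault

  step : Program → Config → Outcome
  step P c = execAt (head (drop (Config.pc c) P)) c

  -- HaltsFrom P c t i j: started in c, P executes exactly t instructions, the last of which
  -- returns (i , j).
  data HaltsFrom (P : Program) : Config → ℕ → ℕ → ℕ → Set where
    stop : ∀ {c i j} → step P c ≡ returned i j → HaltsFrom P c 1 i j
    next : ∀ {c c′ t i j} → step P c ≡ running c′ → HaltsFrom P c′ t i j →
           HaltsFrom P c (suc t) i j

initial : Config
initial = ⟨ 0 , (λ _ → 0) , (λ _ _ → 0) ⟩

Runs : Program → ∀ {σ n} → Vec (Fin σ) n → ℕ → ℕ → ℕ → Set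
Runs P S t i j = HaltsFrom S P initial t i j

allStrings : ∀ σ n → List (Vec (Fin σ) n)
allStrings σ zero    = [] ∷ []
allStrings σ (suc n) = cartesianProductWith _∷_ (allFin σ) (allStrings σ n)

average : ∀ σ n .{{_ : NonZero σ}} → (Vec (Fin σ) n → ℕ) → ℚᵘ
average σ n f = _/ℚ_ (+ sum (map f (allStrings σ n))) (σ ^ n) {{m^n≢0 σ n}}

n²/σ⁴ : ∀ σ n .{{_ : NonZero σ}} → ℚᵘ
n²/σ⁴ σ n = _/ℚ_ (+ (n ^ 2)) (σ ^ 4) {{m^n≢0 σ 4}}

{-# OPTIONS --safe #-}
module Submission where

-- For i = 1, 2, … the program computes the failure function of S[i..n] in O(n) steps, which
-- reveals the longest unbordered factor starting at i; it stops as soon as the suffixes left are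
-- not longer than the best factor found.  So it takes O(nk) steps if some S[i..n] with i ≤ k is
-- unbordered, and O(n²) steps always.
--
-- Let a be a letter different from S[n].  If S[i..n] starts with the run aᵐ and aᵐ does not occur
-- in the last 2m letters of S, then S[i..n] has no border of length at most 2m: one of length at
-- most m ends with a on one side and with S[n] on the other, and a longer one starts with aᵐ.
-- A border of a given length b > 2m has probability σ⁻ᵇ.  With m = 12 and i ranging over the
-- starts of the first σᵐ⁺⁴ blocks of length m, the probability that no such i works is O(σ⁻⁴).

open import Defs
open import Data.Fin.Base using (Fin)
open import Data.Nat.Base using (ℕ; _≥_; NonZero)
open import Data.Product.Base using (Σ; ∃; ∃₂; _×_; _,_)
open import Data.Vec.Base using (Vec)

-- The machine never looks at `σ`: the length `m`, the blocks and the run serve the analysis only.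
-- As `S[n]` is itself random, the letter of the run cannot be chosen in advance; two letters `a`
-- and `a′` are fixed instead, one of which differs from `S[n]`, and the failures of both are
-- counted. Probabilities become counts over `allStrings` with denominators cleared, and the union
-- bound is a plain sum. Let `Z = σ ^ 4` be the factor to be saved. A block is a run with
-- probability `1/σ ^ m`, so `σ ^ m * Z` blocks all fail with probability at most `1/Z`. This gives
-- `k = σ ^ m * Z * m` starts, and a long border at any of them has probability at most
-- `k/σ ^ (m + m)`, which is at most `1/Z` exactly if `m * (Z * Z) ≤ σ ^ m`. For `σ = 2` the least
-- positive such `m` is 12, and it serves every larger `σ`. Since `k` is independent of `n`, the
-- cost `n * k` is eventually below `n * n / Z`; for large `n` the bound is governed by the
-- quadratic cost of the exceptional strings.

module _ where

  open import Data.Bool.Base using (true; false; if_then_else_)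
  open import Data.Empty using (⊥; ⊥-elim)
  open import Data.Fin.Base using (zero; suc; toℕ)
  open import Data.Fin.Properties using (toℕ-injective) renaming (_≟_ to _≟ᶠ_)
  open import Data.List.Base using (List; []; _∷_; _++_; take; drop; head; map; length; allFin; applyUpTo; cartesianProductWith)
  open import Data.List.Properties using (length-take; length-drop; map-++; map-∘; map-tabulate; length-tabulate)
  open import Data.List.Relation.Binary.Pointwise using (Pointwise-≡⇒≡; ≡⇒Pointwise-≡)
  open import Data.List.Relation.Binary.Prefix.Heterogeneous using (Prefix; []; _∷_)
  open import Data.List.Relation.Binary.Suffix.Heterogeneous using (Suffix; here; there)
  open import Data.Maybe.Base using (Maybe; just; nothing)
  open import Data.Maybe.Properties using (just-injective)
  open import Data.Nat.Base
  open import Data.Nat.ListAction using (sum)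
  open import Data.Nat.ListAction.Properties using (sum-++)
  open import Data.Nat.Properties
  open import Data.Nat.Tactic.RingSolver using (solve-∀)
  open import Data.Product.Base using (proj₁; proj₂)
  open import Data.Sum.Base using (_⊎_; inj₁; inj₂)
  open import Data.Unit.Base using (tt)
  open import Data.Vec.Base using ([]; _∷_; toList)
  open import Data.Vec.Properties using (length-toList)
  open import Function.Base using (_∘_; id)
  open import Relation.Binary.PropositionalEquality
  open import Relation.Nullary.Decidable.Core using (yes; no)
  open import Relation.Nullary.Negation.Core using (¬_)
  import Data.Integer.Base as ℤ
  import Data.Integer.Properties as ℤ
  import Data.Rational.Unnormalised.Base as ℚ

  -- Borders of the prefixes of a sequence

  module _ {L : Set} (t : ℕ → L) where

    Agree : ℕ → ℕ → Set
    Agree d b = ∀ {x} → x < b → t x ≡ t (d + x)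

    BorderLength : ℕ → ℕ → Set
    BorderLength l b = ∃ λ d → suc d + b ≡ l × Agree (suc d) b

    NoBorder : ℕ → Set
    NoBorder l = ∀ {b} → BorderLength l (suc b) → ⊥

    LongestBorder : ℕ → ℕ → Set
    LongestBorder l q = BorderLength l q × (∀ {b} → BorderLength l b → b ≤ q)

    -- The state of the search for the longest border of the prefix of length suc l.
    Candidate : ℕ → ℕ → Set
    Candidate l q = BorderLength l q × (∀ {b} → BorderLength (suc l) (suc b) → b ≤ q)

    borderLength-zero : ∀ l → BorderLength (suc l) 0
    borderLength-zero l = l , cong suc (+-identityʳ l) , λ ()

    borderLength-< : ∀ {l b} → BorderLength l b → b < l
    borderLength-< {b = b} (d , refl , _) = s≤s (m≤n+m b d)

    borderLength-trans : ∀ {l q b} → BorderLength l q → BorderLength q b → BorderLength l b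
    borderLength-trans {b = b} (d , refl , A) (e , refl , B) =
      d + suc e , cong suc (+-assoc d (suc e) b) , λ {x} x<b →
        trans (B x<b) (trans (A (+-monoʳ-< (suc e) x<b))
          (cong t (sym (+-assoc (suc d) (suc e) x))))

    -- The suffix of length `b` lies inside the suffix of length `q`, which is a copy of the prefix
    -- of length `q`. The periods subtract: `e≡` gives the new one, `suc f`.
    borderLength-restrict : ∀ {l q b} → BorderLength l q → BorderLength l b → b < q → BorderLength q b
    borderLength-restrict {l} {q} {b} (d , p , A) (e , r , B) b<q with m≤n⇒∃[o]m+o≡n b<q
    ... | f , refl = f , cong suc (+-comm f b) , λ {x} x<b →
        trans (B x<b) (trans (cong t (trans (cong (_+ x) e≡) (+-assoc (suc d) (suc f) x)))
          (sym (A (≤-trans (+-monoʳ-< (suc f) x<b) (≤-reflexive (cong suc (+-comm f b)))))))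
      where
      rearrange : ∀ d b f → suc d + (suc b + f) ≡ suc d + suc f + b
      rearrange = solve-∀

      e≡ : suc e ≡ suc d + suc f
      e≡ = +-cancelʳ-≡ b (suc e) (suc d + suc f)
        (trans r (trans (sym p) (rearrange d b f)))

    borderLength-snoc : ∀ {l b} → BorderLength l b → t b ≡ t l → BorderLength (suc l) (suc b)
    borderLength-snoc {b = b} (d , refl , A) tb≡ = d , +-suc (suc d) b , agree
      where
      agree : Agree (suc d) (suc b)
      agree {x} x≤b with m≤n⇒m<n∨m≡n (s≤s⁻¹ x≤b)
      ... | inj₁ x<b  = A x<b
      ... | inj₂ refl = tb≡

    borderLength-unsnoc : ∀ {l b} → BorderLength (suc l) (suc b) → BorderLength l b × t b ≡ t l
    borderLength-unsnoc {l} {b} (d , p , A) =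
      (d , p′ , A ∘ m<n⇒m<1+n) , trans (A ≤-refl) (cong t p′)
      where
      p′ : suc d + b ≡ l
      p′ = suc-injective (trans (sym (+-suc (suc d) b)) p)

    longestBorder⇒candidate : ∀ {l q} → LongestBorder l q → Candidate l q
    longestBorder⇒candidate (B , max) = B , max ∘ proj₁ ∘ borderLength-unsnoc

    candidate-match : ∀ {l q} → Candidate l q → t q ≡ t l → LongestBorder (suc l) (suc q)
    candidate-match {l} {q} (B , max) tq≡ = borderLength-snoc B tq≡ , longest
      where
      longest : ∀ {b} → BorderLength (suc l) b → b ≤ suc q
      longest {zero}  _  = z≤n
      longest {suc b} B′ = s≤s (max B′)

    candidate-mismatch-zero : ∀ {l} → Candidate l 0 → t 0 ≢ t l → LongestBorder (suc l) 0
    candidate-mismatch-zero {l} (_ , max) t0≢ = borderLength-zero l , longest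
      where
      longest : ∀ {b} → BorderLength (suc l) b → b ≤ 0
      longest {zero}  _ = z≤n
      longest {suc b} B with refl ← n≤0⇒n≡0 (max B) = ⊥-elim (t0≢ (proj₂ (borderLength-unsnoc B)))

    -- A border of the longer prefix extends a border of length `b ≤ q`. The mismatch excludes
    -- `b = q`, so what is extended is a border of the prefix of length `q`, hence at most `f`: no
    -- border is lost by falling back to the failure function.
    candidate-mismatch : ∀ {l q f} → Candidate l q → t q ≢ t l → LongestBorder q f → Candidate l f
    candidate-mismatch {l} {q} (B , max) tq≢ (C , longest) =
      borderLength-trans B C , λ {b} B′ →
        let B₁ , tb≡ = borderLength-unsnoc B′ in
        longest (borderLength-restrict B B₁ (≤∧≢⇒< (max B′) λ { refl → tq≢ tb≡ }))

  -- Borders of a factor in terms of the letters of the string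

  module _ {A : Set} where

    at : List A → ℕ → Maybe A
    at w k = head (drop k w)

    at-injective : ∀ (u v : List A) → (∀ k → at u k ≡ at v k) → u ≡ v
    at-injective []      []      _ = refl
    at-injective []      (y ∷ v) h with () ← h 0
    at-injective (x ∷ u) []      h with () ← h 0
    at-injective (x ∷ u) (y ∷ v) h with refl ← h 0 = cong (x ∷_) (at-injective u v (h ∘ suc))

    at-overflow : ∀ (w : List A) {k} → length w ≤ k → at w k ≡ nothing
    at-overflow []      {zero}  _ = refl
    at-overflow []      {suc k} _ = refl
    at-overflow (x ∷ w) (s≤s le)  = at-overflow w le

    at-take : ∀ (w : List A) {l k} → k < l → at (take l w) k ≡ at w k
    at-take []      {suc l} {zero}  _        = refl
    at-take []      {suc l} {suc k} _        = refl
    at-take (x ∷ w) {suc l} {zero}  _        = refl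
    at-take (x ∷ w) {suc l} {suc k} (s≤s k<l) = at-take w k<l

    at-drop : ∀ (w : List A) d k → at (drop d w) k ≡ at w (d + k)
    at-drop w       zero    k       = refl
    at-drop []      (suc d) zero    = refl
    at-drop []      (suc d) (suc k) = refl
    at-drop (x ∷ w) (suc d) k       = at-drop w d k

    take-prefix : ∀ k (w : List A) → Prefix _≡_ (take k w) w
    take-prefix zero    w       = []
    take-prefix (suc k) []      = []
    take-prefix (suc k) (x ∷ w) = refl ∷ take-prefix k w

    drop-suffix : ∀ k (w : List A) → Suffix _≡_ (drop k w) w
    drop-suffix zero    w       = here (≡⇒Pointwise-≡ refl)
    drop-suffix (suc k) []      = here (≡⇒Pointwise-≡ refl)
    drop-suffix (suc k) (x ∷ w) = there (drop-suffix k w)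

    prefix-at : ∀ {u w : List A} → Prefix _≡_ u w → ∀ {k} → k < length u → at u k ≡ at w k
    prefix-at (refl ∷ p) {zero}  _        = refl
    prefix-at (refl ∷ p) {suc k} (s≤s k<l) = prefix-at p k<l

    suffix-at : ∀ {u w : List A} → Suffix _≡_ u w →
                ∃ λ d → d + length u ≡ length w × (∀ k → at w (d + k) ≡ at u k)
    suffix-at (here p) with refl ← Pointwise-≡⇒≡ p = 0 , refl , λ _ → refl
    suffix-at (there s) = let d , p , h = suffix-at s in suc d , cong suc p , h

    border⇒borderLength : ∀ {u w : List A} → Border u w →
                          ∃ λ b → BorderLength (at w) (length w) (suc b)
    border⇒borderLength {[]} ((u≢[] , _) , _) = ⊥-elim (u≢[] refl)
    border⇒borderLength {_ ∷ _} ((_ , u≢w , _) , here p) = ⊥-elim (u≢w (Pointwise-≡⇒≡ p))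
    border⇒borderLength {_ ∷ u} ((_ , _ , pre) , there s) =
      let d , p , h = suffix-at s in
      length u , d , cong suc p , λ {x} k<l → trans (sym (prefix-at pre k<l)) (sym (h x))

    borderLength⇒border : ∀ (w : List A) {b} → BorderLength (at w) (length w) (suc b) →
                          ∃ λ u → Border u w
    borderLength⇒border w@(_ ∷ _) {b} (d , p , agree) =
      take (suc b) w , ((λ ()) , take≢ , take-prefix (suc b) w) ,
      subst (λ u → Suffix _≡_ u w) (sym take≡drop) (drop-suffix (suc d) w)
      where
      take-length : length (take (suc b) w) ≡ suc b
      take-length = trans (length-take (suc b) w)
        (m≤n⇒m⊓n≡m (≤-trans (m≤n+m (suc b) (suc d)) (≤-reflexive p)))

      take≢ : take (suc b) w ≢ w
      take≢ e = <-irrefl (trans (sym take-length) (cong length e))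
        (≤-trans (s≤s (m≤n+m (suc b) d)) (≤-reflexive p))

      pointwise : ∀ k → at (take (suc b) w) k ≡ at (drop (suc d) w) k
      pointwise k with <-≤-connex k (suc b)
      ... | inj₁ k<b = trans (at-take w k<b) (trans (agree k<b) (sym (at-drop w (suc d) k)))
      ... | inj₂ b≤k = trans
        (at-overflow (take (suc b) w) (≤-trans (≤-reflexive take-length) b≤k))
        (sym (trans (at-drop w (suc d) k)
          (at-overflow w (≤-trans (≤-reflexive (sym p)) (+-monoʳ-≤ (suc d) b≤k)))))

      take≡drop : take (suc b) w ≡ drop (suc d) w
      take≡drop = at-injective _ _ pointwise

    letter-at : ∀ {n} (S : Vec A n) k → letter S (suc k) ≡ at (toList S) k
    letter-at []      zero    = refl
    letter-at []      (suc k) = refl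
    letter-at (x ∷ S) zero    = refl
    letter-at (x ∷ S) (suc k) = letter-at S k

    letter-defined : ∀ {n} (S : Vec A n) {k} → 1 ≤ k → k ≤ n → ∃ λ x → letter S k ≡ just x
    letter-defined (x ∷ S) {suc zero}    _ _        = x , refl
    letter-defined (x ∷ S) {suc (suc k)} _ (s≤s le) = letter-defined S (s≤s z≤n) le

    from : ∀ {n} → Vec A n → ℕ → ℕ → Maybe A
    from S i x = letter S (i + x)

    module _ {n} (S : Vec A n) (i y : ℕ) (in-range : suc i + y ≤ n) where

      private
        factor : List A
        factor = S ⟦ suc i ‥ suc i + y ⟧

        span : suc (suc i + y) ∸ suc i ≡ suc y
        span = trans (cong (_∸ suc i) (sym (+-suc (suc i) y))) (m+n∸m≡n (suc i) (suc y))

      factor-length : length factor ≡ suc y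
      factor-length rewrite span = trans (length-take (suc y) (drop i (toList S)))
        (m≤n⇒m⊓n≡m (subst (suc y ≤_)
          (sym (trans (length-drop i (toList S)) (cong (_∸ i) (length-toList S))))
          (m+n≤o⇒m≤o∸n (suc y) (≤-trans (≤-reflexive (cong suc (+-comm y i))) in-range))))

      factor-at : ∀ {x} → x < suc y → at factor x ≡ from S (suc i) x
      factor-at {x} x≤y rewrite span =
        trans (at-take (drop i (toList S)) x≤y)
          (trans (at-drop (toList S) i x) (sym (letter-at S (i + x))))

      private
        agree-transport : ∀ {t t′ : ℕ → Maybe A} → (∀ {x} → x < suc y → t x ≡ t′ x) →
          ∀ {b} → BorderLength t (suc y) b → BorderLength t′ (suc y) b
        agree-transport t≗t′ {b} (d , refl , agree) = d , refl , λ {x} x<b →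
          trans (sym (t≗t′ (≤-trans x<b (m≤n+m b (suc d)))))
            (trans (agree x<b) (t≗t′ (+-monoʳ-< (suc d) x<b)))

      noBorder⇒unbordered : NoBorder (from S (suc i)) (suc y) → Unbordered factor
      noBorder⇒unbordered none (u , border) =
        let b , B = border⇒borderLength border in
        none {b} (agree-transport factor-at
          (subst (λ l → BorderLength (at factor) l (suc b)) factor-length B))

      unbordered⇒noBorder : Unbordered factor → NoBorder (from S (suc i)) (suc y)
      unbordered⇒noBorder unb {b} B = unb (borderLength⇒border factor
        (subst (λ l → BorderLength (at factor) l (suc b)) (sym factor-length)
          (agree-transport (sym ∘ factor-at) B)))

  -- The program and its execution

  -- Registers: 0 holds n; 1 holds 1; 2 holds 0; 3 is the start i; 4 the end j; 5 the border
  -- length q of S[i..j−1] that is being extended; 6, 7, 8 the length, start and end of the best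
  -- factor so far; 9 is scratch; 10 is the last j with S[i..j] unbordered.
  -- Cell l of array 0 holds the length of the longest border of the prefix of length l of S[i..n].
  program : Program
  program =
    {-  0 -} len 0 ∷
    {-  1 -} const 1 1 ∷
    {-  2 -} const 3 1 ∷
    {-  3 -} arith sub 9 0 3 ∷
    {-  4 -} jumpIf lt 9 6 33 ∷
    {-  5 -} move 4 3 ∷
    {-  6 -} const 5 0 ∷
    {-  7 -} move 10 3 ∷
    {-  8 -} store 0 1 2 ∷
    {-  9 -} jumpIf eq 4 0 23 ∷
    {- 10 -} arith add 4 4 1 ∷
    {- 11 -} arith add 9 3 5 ∷
    {- 12 -} jumpIfLetter eq 9 4 16 ∷
    {- 13 -} jumpIf eq 5 2 18 ∷
    {- 14 -} load 5 0 5 ∷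
    {- 15 -} jump 11 ∷
    {- 16 -} arith add 5 5 1 ∷
    {- 17 -} jump 19 ∷
    {- 18 -} move 10 4 ∷
    {- 19 -} arith sub 9 4 3 ∷
    {- 20 -} arith add 9 9 1 ∷
    {- 21 -} store 0 9 5 ∷
    {- 22 -} jump 9 ∷
    {- 23 -} arith sub 9 10 3 ∷
    {- 24 -} arith add 9 9 1 ∷
    {- 25 -} jumpIf lt 6 9 27 ∷
    {- 26 -} jump 30 ∷
    {- 27 -} move 6 9 ∷
    {- 28 -} move 7 3 ∷
    {- 29 -} move 8 10 ∷
    {- 30 -} jumpIf eq 3 0 33 ∷
    {- 31 -} arith add 3 3 1 ∷
    {- 32 -} jump 3 ∷
    {- 33 -} return 7 8 ∷
    []

  <ᵇ-true : ∀ {x y} → x < y → (x <ᵇ y) ≡ true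
  <ᵇ-true {x} {y} x<y with x <ᵇ y | <⇒<ᵇ x<y
  ... | true | _ = refl

  <ᵇ-false : ∀ {x y} → ¬ x < y → (x <ᵇ y) ≡ false
  <ᵇ-false {x} {y} x≮y with x <ᵇ y | <ᵇ⇒< x y
  ... | true  | lift = ⊥-elim (x≮y (lift tt))
  ... | false | _    = refl

  ≡ᵇ-true : ∀ {x y} → x ≡ y → (x ≡ᵇ y) ≡ true
  ≡ᵇ-true {x} {y} x≡y with x ≡ᵇ y | ≡⇒≡ᵇ x y x≡y
  ... | true | _ = refl

  ≡ᵇ-false : ∀ {x y} → x ≢ y → (x ≡ᵇ y) ≡ false
  ≡ᵇ-false {x} {y} x≢y with x ≡ᵇ y | ≡ᵇ⇒≡ x y
  ... | true  | lift = ⊥-elim (x≢y (lift tt))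
  ... | false | _    = refl

  update-≡ : ∀ {B : Set} (f : ℕ → B) {k m} {v : B} → m ≡ k → (f [ k ↦ v ]) m ≡ v
  update-≡ f m≡k rewrite ≡ᵇ-true m≡k = refl

  update-≢ : ∀ {B : Set} (f : ℕ → B) {k m} {v : B} → m ≢ k → (f [ k ↦ v ]) m ≡ f m
  update-≢ f m≢k rewrite ≡ᵇ-false m≢k = refl

  -- Lets separate derivations, the quadratic one and the one that uses an early unbordered suffix,
  -- bound the time of one and the same run.
  haltsFrom-deterministic : ∀ {σ n} {S : Vec (Fin σ) n} {P c t t′ i i′ j j′} →
    HaltsFrom S P c t i j → HaltsFrom S P c t′ i′ j′ → t ≡ t′
  haltsFrom-deterministic (stop _)   (stop _)    = refl
  haltsFrom-deterministic (stop e)   (next e′ _) with () ← trans (sym e) e′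
  haltsFrom-deterministic (next e _) (stop e′)   with () ← trans (sym e) e′
  haltsFrom-deterministic (next e h) (next e′ h′) with refl ← trans (sym e) e′ =
    cong suc (haltsFrom-deterministic h h′)

  module _ {σ n : ℕ} (S : Vec (Fin σ) n) where

    -- Correctness and remaining time in one, so the verification runs backwards from `return`: each
    -- rule prepends an instruction, and a loop takes the solution at its exit as a hypothesis.
    record Solves (c : Config) (B : ℕ) : Set where
      constructor solves
      field
        {time start end} : ℕ
        time≤   : time ≤ B
        halts   : HaltsFrom S program c time start end
        maximal : IsMaximalUnborderedFactor S start end

    Solves-mono : ∀ {c B B′} → B ≤ B′ → Solves c B → Solves c B′
    Solves-mono B≤B′ (solves t≤B h max) = solves (≤-trans t≤B B≤B′) h max

    one-step : ∀ {c c′ B} → step S program c ≡ running c′ → Solves c′ B → Solves c (suc B)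
    one-step e (solves t≤B h max) = solves (s≤s t≤B) (next e h) max

    -- The machine faults on values above `n`, so every assignment owes a proof of `v ≤ n`. At each
    -- use the equation is `refl`, since fetching computes at a literal program counter.
    assigns : ∀ {pc R M r v B} →
      step S program ⟨ pc , R , M ⟩ ≡ assign S ⟨ pc , R , M ⟩ r v → v ≤ n →
      Solves ⟨ suc pc , R [ r ↦ v ] , M ⟩ B → Solves ⟨ pc , R , M ⟩ (suc B)
    assigns {pc} {R} {M} {r} {v} e v≤n = one-step (trans e fits)
      where
      fits : assign S ⟨ pc , R , M ⟩ r v ≡ running ⟨ suc pc , R [ r ↦ v ] , M ⟩
      fits with v ≤ᵇ n | ≤⇒≤ᵇ v≤n
      ... | true | _ = refl

    branches : ∀ {pc R M ℓ B} b {b′} → b ≡ b′ →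
      step S program ⟨ pc , R , M ⟩ ≡ branch S ⟨ pc , R , M ⟩ b ℓ →
      Solves ⟨ (if b′ then ℓ else suc pc) , R , M ⟩ B → Solves ⟨ pc , R , M ⟩ (suc B)
    branches b refl e = one-step e

    -- As an alias of a product of equations, Frame is definitionally unaffected by assignments to
    -- the other registers.
    Frame : (Reg → ℕ) → ℕ → ℕ → ℕ → ℕ → Set
    Frame R i best bi bj = R 0 ≡ n × R 1 ≡ 1 × R 2 ≡ 0 × R 3 ≡ i × R 6 ≡ best × R 7 ≡ bi × R 8 ≡ bj

    -- The failure function of one suffix

    module Scan (i : ℕ) (1≤i : 1 ≤ i) (best bi bj : ℕ) where

      t : ℕ → Maybe (Fin σ)
      t = from S i

      Failures : (Arr → ℕ → ℕ) → ℕ → Set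
      Failures M y = ∀ {l} → l ≤ y → LongestBorder t (suc l) (M 0 (suc l))

      LastUnbordered : ℕ → ℕ → Set
      LastUnbordered y z = z ≤ y × NoBorder t (suc z) × (∀ {l} → z < l → l ≤ y → ¬ NoBorder t (suc l))

      InnerRegs : (Reg → ℕ) → ℕ → ℕ → ℕ → Set
      InnerRegs R y q z = Frame R i best bi bj × R 4 ≡ i + y × R 5 ≡ q × R 10 ≡ i + z

      Failures-store : ∀ {M y q a v} → Failures M y → LongestBorder t (suc (suc y)) q →
        a ≡ suc (suc y) → v ≡ q → Failures (M [ 0 ↦ M 0 [ a ↦ v ] ]) (suc y)
      Failures-store {M} F lb refl refl {l} l≤ with m≤n⇒m<n∨m≡n l≤
      ... | inj₂ refl = subst (LongestBorder t _) (sym (update-≡ (M 0) refl)) lb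
      ... | inj₁ l<   = subst (LongestBorder t _)
                          (sym (update-≢ (M 0) (<⇒≢ (s≤s l<)))) (F (s≤s⁻¹ l<))

      lastUnbordered-bordered : ∀ {y z q} → LongestBorder t (suc (suc y)) (suc q) →
        LastUnbordered y z → LastUnbordered (suc y) z
      lastUnbordered-bordered {y} {z} lb (z≤y , none , last) = m≤n⇒m≤1+n z≤y , none , last′
        where
        last′ : ∀ {l} → z < l → l ≤ suc y → ¬ NoBorder t (suc l)
        last′ z<l l≤ nb with m≤n⇒m<n∨m≡n l≤
        ... | inj₁ l<   = last z<l (s≤s⁻¹ l<) nb
        ... | inj₂ refl = nb (proj₁ lb)

      longestBorder-zero : ∀ {l} → LongestBorder t l 0 → NoBorder t l
      longestBorder-zero (_ , max) B with () ← max B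

      lastUnbordered-unbordered : ∀ {y} → LongestBorder t (suc y) 0 → LastUnbordered y y
      lastUnbordered-unbordered lb =
        ≤-refl , longestBorder-zero lb , λ z<l l≤ → ⊥-elim (<⇒≱ z<l l≤)

      candidate-fits : ∀ {l q} → Candidate t l q → i + l ≤ n → i + q ≤ n
      candidate-fits cand = ≤-trans (+-monoʳ-≤ i (<⇒≤ (borderLength-< t (proj₁ cand))))

      Searched : ℕ → ℕ → ℕ → Set
      Searched y q z = LongestBorder t (suc (suc y)) q × LastUnbordered (suc y) z

      -- Amortised with the potential `5 * q`. A fallback takes 5 instructions and lowers `q` by at
      -- least 1, so it pays for itself; a match takes 4 and raises the potential by 5, whence the
      -- 9. The fuel `g` bounds `q`, because the next candidate is read from the array and is not
      -- structurally smaller.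
      search : ∀ {M y z B} → i + suc y ≤ n → Failures M y → LastUnbordered y z →
        (∀ {R q z} → InnerRegs R (suc y) q z → Searched y q z → Solves ⟨ 19 , R , M ⟩ (5 * q + B)) →
        ∀ g {R q} → q ≤ g → InnerRegs R (suc y) q z → Candidate t (suc y) q →
        Solves ⟨ 11 , R , M ⟩ (9 + (5 * q + B))
      search {M} {y} {z} {B} fits F last continue g {R} {q} q≤g
        (frame@(r0 , r1 , r2 , r3 , r6 , r7 , r8) , r4 , r5 , r10) cand
        with letter-defined S {i + q} (≤-trans 1≤i (m≤m+n i q)) (candidate-fits cand fits)
           | letter-defined S {i + suc y} (≤-trans 1≤i (m≤m+n i (suc y))) fits
      ... | a , a≡ | b , b≡ =
        assigns refl (≤-trans (≤-reflexive r3+r5) i+q≤n) compare-letters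
        where
        i+q≤n : i + q ≤ n
        i+q≤n = candidate-fits cand fits

        r3+r5 : R 3 + R 5 ≡ i + q
        r3+r5 = cong₂ _+_ r3 r5

        R₁ : Reg → ℕ
        R₁ = R [ 9 ↦ R 3 + R 5 ]

        letters : step S program ⟨ 12 , R₁ , M ⟩ ≡ branch S ⟨ 12 , R₁ , M ⟩ (toℕ a ≡ᵇ toℕ b) 16
        letters rewrite trans (cong (letter S) r3+r5) a≡ | trans (cong (letter S) r4) b≡ = refl

        compare-letters : Solves ⟨ 12 , R₁ , M ⟩ (8 + (5 * q + B))
        compare-letters with toℕ a ≟ toℕ b
        ... | yes a≡b = branches _ (≡ᵇ-true a≡b) letters
              (assigns refl (subst (_≤ n) (sym q+1) q<n)
              (one-step refl
              (Solves-mono (≤-reflexive (cong (_+ B) (*-suc 5 q)))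
              (continue (frame , r4 , q+1 , r10)
                (lb , lastUnbordered-bordered lb last)))))
          where
          q+1 : R 5 + R 1 ≡ suc q
          q+1 = trans (cong₂ _+_ r5 r1) (+-comm q 1)

          q<n : suc q ≤ n
          q<n = ≤-trans (borderLength-< t (proj₁ cand)) (≤-trans (m≤n+m (suc y) i) fits)

          lb : LongestBorder t (suc (suc y)) (suc q)
          lb = candidate-match t cand (trans a≡ (trans (cong just (toℕ-injective a≡b)) (sym b≡)))
        ... | no a≢b = branches _ (≡ᵇ-false a≢b) letters (mismatch g q refl q≤g)
          where
          tq≢ : t q ≢ t (suc y)
          tq≢ e = a≢b (cong toℕ (just-injective (trans (sym a≡) (trans e b≡))))

          mismatch : ∀ g q′ → q ≡ q′ → q ≤ g → Solves ⟨ 13 , R₁ , M ⟩ (7 + (5 * q + B))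
          mismatch _ zero refl _ = branches _ (≡ᵇ-true (trans r5 (sym r2))) refl
            (assigns refl (subst (_≤ n) (sym r4) fits)
            (Solves-mono (m≤n+m B 5)
            (continue (frame , r4 , r5 , r4)
              (lb , lastUnbordered-unbordered lb))))
            where
            lb : LongestBorder t (suc (suc y)) 0
            lb = candidate-mismatch-zero t cand tq≢
          mismatch (suc g) (suc q′) refl (s≤s q′≤g) =
            branches _ (≡ᵇ-false λ e → 1+n≢0 (trans (sym r5) (trans e r2))) refl
            (assigns refl (≤-trans (≤-reflexive load≡) (≤-trans (<⇒≤ f<q) q≤n))
            (one-step refl
            (Solves-mono bound
            (search fits F last continue g (≤-trans (s≤s⁻¹ f<q) q′≤g)
              (frame , r4 , load≡ , r10)
              (candidate-mismatch t cand tq≢ lbf)))))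
            where
            f : ℕ
            f = M 0 (suc q′)

            load≡ : M 0 (R 5) ≡ f
            load≡ = cong (M 0) r5

            q<y : suc q′ < suc y
            q<y = borderLength-< t (proj₁ cand)

            q≤n : suc q′ ≤ n
            q≤n = ≤-trans (m≤n+m (suc q′) i) i+q≤n

            lbf : LongestBorder t (suc q′) f
            lbf = F (<⇒≤ (s≤s⁻¹ q<y))

            f<q : f < suc q′
            f<q = borderLength-< t (proj₁ lbf)

            bound : 9 + (5 * f + B) ≤ 4 + (5 * suc q′ + B)
            bound = +-monoʳ-≤ 4 (≤-trans (≤-reflexive (cong (_+ B) (sym (*-suc 5 f))))
              (+-monoˡ-≤ B (*-monoʳ-≤ 5 f<q)))

      scan : ∀ {B} →
        (∀ {R M y q z} → i + y ≡ n → InnerRegs R y q z → LastUnbordered y z →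
          Solves ⟨ 23 , R , M ⟩ B) →
        ∀ e {R M y q z} → i + y + e ≡ n → InnerRegs R y q z →
        Failures M y → LongestBorder t (suc y) q → LastUnbordered y z →
        Solves ⟨ 9 , R , M ⟩ (15 * e + (5 * q + suc B))
      scan {B} continue zero {R} {M} {y} {q} end
        regs@((r0 , _) , r4 , _) F lb last =
        Solves-mono (m≤n+m (suc B) (5 * q))
        (branches _ (≡ᵇ-true (trans r4 (trans y-end (sym r0)))) refl
        (continue y-end regs last))
        where
        y-end : i + y ≡ n
        y-end = trans (sym (+-identityʳ _)) end
      scan {B} continue (suc e) {R} {M} {y} {q} end
        (frame@(r0 , r1 , r2 , r3 , r6 , r7 , r8) , r4 , r5 , r10) F lb last =
        Solves-mono (≤-reflexive (bound e q B))
        (branches _ (≡ᵇ-false not-end) refl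
        (assigns refl (subst (_≤ n) (sym r4+1) fits)
        (search fits F last store-border q ≤-refl
          (frame , r4+1 , r5 , r10)
          (longestBorder⇒candidate t lb))))
        where
        -- Per letter: 2 for the end test and the increment of `j`, 9 for the amortised search, 4 to
        -- store the border length and jump back.
        bound : ∀ e q B → 2 + (9 + (5 * q + (4 + (15 * e + suc B)))) ≡ 15 * suc e + (5 * q + suc B)
        bound = solve-∀

        end′ : i + suc y + e ≡ n
        end′ = trans (cong (_+ e) (+-suc i y)) (trans (sym (+-suc (i + y) e)) end)

        fits : i + suc y ≤ n
        fits = ≤-trans (m≤m+n (i + suc y) e) (≤-reflexive end′)

        r4+1 : R 4 + R 1 ≡ i + suc y
        r4+1 = trans (cong₂ _+_ r4 r1) (trans (+-comm _ 1) (sym (+-suc i y)))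

        not-end : R 4 ≢ R 0
        not-end r4≡r0 = <⇒≢ (subst (_≤ n) (+-suc i y) fits) (trans (sym r4) (trans r4≡r0 r0))

        store-border : ∀ {R q z} → InnerRegs R (suc y) q z → Searched y q z →
          Solves ⟨ 19 , R , M ⟩ (5 * q + (4 + (15 * e + suc B)))
        store-border {R} {q} (frame@(r0 , r1 , r2 , r3 , r6 , r7 , r8) , r4 , r5 , r10) (lb , last) =
          Solves-mono (≤-reflexive (bound′ e q B))
          (assigns refl (≤-trans (≤-reflexive length≡) (≤-trans (m≤n+m (suc y) i) fits))
          (assigns refl (≤-trans (≤-reflexive length+1≡) (≤-trans (+-monoˡ-≤ (suc y) 1≤i) fits))
          (one-step refl
          (one-step refl
          (scan continue e end′ (frame , r4 , r5 , r10)
            (Failures-store {M} F lb length+1≡ r5) lb last)))))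
          where
          bound′ : ∀ e q B → 4 + (15 * e + (5 * q + suc B)) ≡ 5 * q + (4 + (15 * e + suc B))
          bound′ = solve-∀

          length≡ : R 4 ∸ R 3 ≡ suc y
          length≡ = trans (cong₂ _∸_ r4 r3) (m+n∸m≡n i (suc y))

          length+1≡ : R 4 ∸ R 3 + R 1 ≡ suc (suc y)
          length+1≡ = trans (cong₂ _+_ length≡ r1) (+-comm (suc y) 1)

    -- The search over all starting positions

    Occurs : ℕ → ℕ → Set
    Occurs i y = suc i + y ≤ n × NoBorder (from S (suc i)) (suc y)

    -- `best ≡ 0` is the initial state, in which `bi` and `bj` do not yet describe a factor.
    Found : ℕ → ℕ → ℕ → Set
    Found best bi bj = best ≡ 0 ⊎
      ∃₂ λ i y → best ≡ suc y × bi ≡ suc i × bj ≡ suc i + y × Occurs i y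

    BestBefore : ℕ → ℕ → Set
    BestBefore i best = ∀ {i′ y} → i′ < i → Occurs i′ y → suc y ≤ best

    -- The inequality is the exit test of the program: the suffix that starts at position `suc i`
    -- has `n ∸ i` letters, which is at most `best`, so neither it nor any later start can do
    -- better. Being strict, it also rules out the initial state.
    found-maximal : ∀ {i best bi bj} → Found best bi bj → BestBefore i best → n ∸ suc i < best →
      IsMaximalUnborderedFactor S bi bj
    found-maximal (inj₁ refl) _ ()
    found-maximal {i} (inj₂ (i₀ , y , refl , refl , refl , fits , none)) before rest<best =
      (s≤s z≤n , m≤m+n (suc i₀) y , fits) , noBorder⇒unbordered S i₀ y fits none , longest
      where
      longest : ∀ i′ j′ → FactorBounds n i′ j′ → Unbordered (S ⟦ i′ ‥ j′ ⟧) →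
        length (S ⟦ i′ ‥ j′ ⟧) ≤ length (S ⟦ suc i₀ ‥ suc i₀ + y ⟧)
      longest (suc i′) j′ (_ , i′≤j′ , j′≤n) unb with m≤n⇒∃[o]m+o≡n i′≤j′
      ... | y′ , refl = subst₂ _≤_ (sym (factor-length S i′ y′ j′≤n)) (sym (factor-length S i₀ y fits))
              (shorter (<-≤-connex i′ i))
        where
        shorter : i′ < i ⊎ i ≤ i′ → suc y′ ≤ suc y
        shorter (inj₁ i′<i) = before i′<i (j′≤n , unbordered⇒noBorder S i′ y′ j′≤n unb)
        shorter (inj₂ i≤i′) = ≤-trans
          (s≤s (≤-trans (m+n≤o⇒m≤o∸n y′ (subst (_≤ n) (+-comm (suc i′) y′) j′≤n))
            (∸-monoʳ-≤ n (s≤s i≤i′)))) rest<best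

    returns : ∀ {R M bi bj} → R 7 ≡ bi → R 8 ≡ bj →
      IsMaximalUnborderedFactor S bi bj → Solves ⟨ 33 , R , M ⟩ 1
    returns refl refl max = solves ≤-refl (stop refl) max

    module _ (m : ℕ) {i₀ y₀ : ℕ} (i₀<m : i₀ < m) (occurs : Occurs i₀ y₀) (n≤ : n ≤ suc y₀ + m) where

      -- Here `e` counts the rounds left out of `m`. After `m` rounds the given factor has been met,
      -- so `best ≥ suc y₀`, while the suffixes left have at most `n ∸ m ≤ suc y₀` letters: the exit
      -- test succeeds. The 3 pays for the last subtraction, test and return.
      search-from : ∀ e {i R M best bi bj} → i + e ≡ m → suc i ≤ n → Frame R (suc i) best bi bj →
        Found best bi bj → BestBefore i best → Solves ⟨ 3 , R , M ⟩ (3 + e * (16 * n))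

      advance : ∀ e {i R M best bi bj} → i + suc e ≡ m → suc i ≤ n → Frame R (suc i) best bi bj →
        Found best bi bj → BestBefore (suc i) best → 1 ≤ best →
        Solves ⟨ 30 , R , M ⟩ (3 + (3 + e * (16 * n)))
      advance e {i} {R} {best = best} i+e i<n (r0 , r1 , r2 , r3 , r6 , r7 , r8) found before 1≤best
        with suc i ≟ n
      ... | yes i+1≡n = Solves-mono (s≤s (s≤s z≤n))
            (branches _ (≡ᵇ-true (trans r3 (trans i+1≡n (sym r0)))) refl
            (returns r7 r8 (found-maximal found before
              (subst (_< best) (sym (m≤n⇒m∸n≡0 (m≤n⇒m≤1+n (≤-reflexive (sym i+1≡n))))) 1≤best))))
      ... | no i+1≢n =
            branches _ (≡ᵇ-false λ r3≡r0 → i+1≢n (trans (sym r3) (trans r3≡r0 r0))) refl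
            (assigns refl (subst (_≤ n) (sym r3+1) i+1<n)
            (one-step refl
            (search-from e (trans (sym (+-suc i e)) i+e) i+1<n
              (r0 , r1 , r2 , r3+1 , r6 , r7 , r8) found before)))
        where
        i+1<n : suc (suc i) ≤ n
        i+1<n = ≤∧≢⇒< i<n i+1≢n

        r3+1 : R 3 + R 1 ≡ suc (suc i)
        r3+1 = trans (cong₂ _+_ r3 r1) (+-comm (suc i) 1)

      search-from e {i} {R} {M} {best} {bi} {bj} i+e i<n frame@(r0 , r1 , r2 , r3 , r6 , r7 , r8)
        found before = assigns refl (≤-trans (≤-reflexive rest≡) (m∸n≤m n (suc i))) test
        where
        open Scan (suc i) (s≤s z≤n) best bi bj

        rest≡ : R 0 ∸ R 3 ≡ n ∸ suc i
        rest≡ = cong₂ _∸_ r0 r3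

        R₁ : Reg → ℕ
        R₁ = R [ 9 ↦ R 0 ∸ R 3 ]

        longestBorder-one : LongestBorder t 1 0
        longestBorder-one = borderLength-zero t 0 , λ B → s≤s⁻¹ (borderLength-< t B)

        update-best : ∀ e {R M y q z} → i + suc e ≡ m → suc i + y ≡ n → InnerRegs R y q z →
          LastUnbordered y z → Solves ⟨ 23 , R , M ⟩ (6 + (3 + (3 + e * (16 * n))))
        update-best e {R} {M} {y} {q} {z} i+e end
          (frame@(r0 , r1 , r2 , r3 , r6 , r7 , r8) , r4 , r5 , r10) (z≤y , none , last) =
          assigns refl (≤-trans (≤-reflexive length≡) z≤n′)
          (assigns refl (≤-trans (≤-reflexive length+1≡) z<n) compare-lengths)
          where
          fits : suc i + z ≤ n
          fits = ≤-trans (+-monoʳ-≤ (suc i) z≤y) (≤-reflexive end)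

          z<n : suc z ≤ n
          z<n = ≤-trans (s≤s (m≤n+m z i)) fits

          z≤n′ : z ≤ n
          z≤n′ = <⇒≤ z<n

          length≡ : R 10 ∸ R 3 ≡ z
          length≡ = trans (cong₂ _∸_ r10 r3) (m+n∸m≡n (suc i) z)

          length+1≡ : R 10 ∸ R 3 + R 1 ≡ suc z
          length+1≡ = trans (cong₂ _+_ length≡ r1) (+-comm z 1)

          before′ : ∀ {best′} → best ≤ best′ → suc z ≤ best′ → BestBefore (suc i) best′
          before′ best≤ z≤ {i′} {y′} i′≤i occ@(fits′ , none′) with m≤n⇒m<n∨m≡n (s≤s⁻¹ i′≤i)
          ... | inj₁ i′<i = ≤-trans (before i′<i occ) best≤
          ... | inj₂ refl = ≤-trans (s≤s (≮⇒≥ λ z<y′ → last z<y′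
                  (+-cancelˡ-≤ (suc i) _ _ (≤-trans fits′ (≤-reflexive (sym end)))) none′)) z≤

          R₂ : Reg → ℕ
          R₂ = (R [ 9 ↦ R 10 ∸ R 3 ]) [ 9 ↦ R 10 ∸ R 3 + R 1 ]

          compare-lengths : Solves ⟨ 25 , R₂ , M ⟩ (4 + (3 + (3 + e * (16 * n))))
          compare-lengths with best <? suc z
          ... | yes best<z =
                branches _ (<ᵇ-true (subst₂ _<_ (sym r6) (sym length+1≡) best<z)) refl
                (assigns refl (≤-trans (≤-reflexive length+1≡) z<n)
                (assigns refl (≤-trans (≤-reflexive r3) i<n)
                (assigns refl (≤-trans (≤-reflexive r10) fits)
                (advance e i+e i<n (r0 , r1 , r2 , r3 , length+1≡ , r3 , r10)
                  (inj₂ (i , z , refl , refl , refl , fits , none))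
                  (before′ (<⇒≤ best<z) ≤-refl) (s≤s z≤n)))))
          ... | no best≮z =
                branches _ (<ᵇ-false λ r6<r9 → best≮z (subst₂ _<_ r6 length+1≡ r6<r9)) refl
                (one-step refl
                (Solves-mono (m≤n+m _ 2)
                (advance e i+e i<n frame found
                  (before′ ≤-refl (≮⇒≥ best≮z)) (≤-trans (s≤s z≤n) (≮⇒≥ best≮z)))))

        -- A full round takes 16 instructions besides the 15 per further letter: 2 for the exit
        -- test, 4 to set up, 1 to leave the scan, at most 6 to update the best factor and 3 to
        -- advance. For a suffix of `suc r` letters this is at most `16 * suc r`.
        bound : ∀ e → 4 + (15 * (n ∸ suc i) + suc (6 + (3 + (3 + e * (16 * n))))) ≤
                      1 + suc e * (16 * n)
        bound e = begin
          4 + (15 * r + suc (6 + (3 + (3 + X)))) ≡⟨ rearrange r X ⟩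
          1 + (16 + 15 * r + X)                  ≤⟨ +-monoʳ-≤ 1 (+-monoˡ-≤ X 16+15r≤) ⟩
          1 + (16 * n + X)                       ∎
          where
          open ≤-Reasoning

          r X : ℕ
          r = n ∸ suc i
          X = e * (16 * n)

          rearrange : ∀ r X → 4 + (15 * r + suc (6 + (3 + (3 + X)))) ≡ 1 + (16 + 15 * r + X)
          rearrange = solve-∀

          16+15r≤ : 16 + 15 * r ≤ 16 * n
          16+15r≤ = begin
            16 + 15 * r ≤⟨ +-monoʳ-≤ 16 (*-monoˡ-≤ r (n≤1+n 15)) ⟩
            16 + 16 * r ≡⟨ *-suc 16 r ⟨
            16 * suc r  ≤⟨ *-monoʳ-≤ 16 (∸-monoʳ-< (s≤s z≤n) i<n) ⟩
            16 * n      ∎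

        iterate : ∀ e → i + e ≡ m → ¬ n ∸ suc i < best → Solves ⟨ 5 , R₁ , M ⟩ (1 + e * (16 * n))
        iterate zero i+0≡m rest≮best =
          ⊥-elim (<⇒≱ {n} {best + suc i} n<
            (m≤o∸n⇒m+n≤o best i<n (≮⇒≥ rest≮best)))
          where
          i≡m : i ≡ m
          i≡m = trans (sym (+-identityʳ i)) i+0≡m

          n< : n < best + suc i
          n< = ≤-trans (s≤s (≤-trans n≤ (+-mono-≤ (before (subst (i₀ <_) (sym i≡m) i₀<m) occurs)
                 (≤-reflexive (sym i≡m))))) (≤-reflexive (sym (+-suc best i)))
        iterate (suc e) i+e rest≮best =
          Solves-mono (bound e)
          (assigns refl r3≤n
          (assigns refl z≤n
          (assigns refl r3≤n
          (one-step refl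
          (scan (update-best e i+e) (n ∸ suc i) (trans (cong (_+ (n ∸ suc i)) (+-identityʳ (suc i)))
              (m+[n∸m]≡n i<n))
            (frame , r3′ , refl , r3′)
            failures longestBorder-one (lastUnbordered-unbordered longestBorder-one))))))
          where
          r3≤n : R 3 ≤ n
          r3≤n = ≤-trans (≤-reflexive r3) i<n

          r3′ : R 3 ≡ suc i + 0
          r3′ = trans r3 (sym (+-identityʳ (suc i)))

          failures : Failures (M [ 0 ↦ M 0 [ R 1 ↦ R 2 ] ]) 0
          failures z≤n = subst (LongestBorder t 1)
            (sym (trans (update-≡ (M 0) (sym r1)) r2)) longestBorder-one

        test : Solves ⟨ 4 , R₁ , M ⟩ (2 + e * (16 * n))
        test with n ∸ suc i <? best
        ... | yes rest<best =
              branches _ (<ᵇ-true (subst₂ _<_ (sym rest≡) (sym r6) rest<best)) refl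
              (Solves-mono (s≤s z≤n) (returns r7 r8 (found-maximal found before rest<best)))
        ... | no rest≮best =
              branches _ (<ᵇ-false λ r9<r6 → rest≮best (subst₂ _<_ rest≡ r6 r9<r6)) refl
              (iterate e i+e rest≮best)

      solves-within : 1 ≤ n → Solves initial (22 * (n * m))
      solves-within 1≤n = Solves-mono bound
        (assigns refl ≤-refl
        (assigns refl 1≤n
        (assigns refl 1≤n
        (search-from m refl 1≤n (refl , refl , refl , refl , refl , refl , refl) (inj₁ refl) λ ()))))
        where
        -- The 6 are three initial assignments and the final 3 of `search-from`; `n * m` is positive
        -- and absorbs them.
        bound : 6 + m * (16 * n) ≤ 22 * (n * m)
        bound = begin
          6 + m * (16 * n)               ≡⟨ cong (6 +_) (rearrange m n) ⟩
          6 * 1 + 16 * (n * m)           ≤⟨ +-monoˡ-≤ (16 * (n * m))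
                                              (*-monoʳ-≤ 6 (*-mono-≤ 1≤n (≤-trans (s≤s z≤n) i₀<m))) ⟩
          6 * (n * m) + 16 * (n * m)     ≡⟨ *-distribʳ-+ (n * m) 6 16 ⟨
          22 * (n * m)                   ∎
          where
          open ≤-Reasoning

          rearrange : ∀ m n → m * (16 * n) ≡ 16 * (n * m)
          rearrange = solve-∀

    -- The quadratic bound is the case `m = n`: the single letter `S[1]` is an unbordered factor of
    -- sufficient length.
    solves-always : 1 ≤ n → Solves initial (22 * (n * n))
    solves-always 1≤n = solves-within n {0} {0} 1≤n (1≤n , noBorder-one) (n≤1+n n) 1≤n
      where
      noBorder-one : NoBorder (from S 1) 1
      noBorder-one B with s≤s () ← borderLength-< (from S 1) B

  -- Finite sums

  module _ {A : Set} where

    ∑ : List A → (A → ℕ) → ℕ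
    ∑ xs f = sum (map f xs)

    ∑-mono : ∀ xs {f g : A → ℕ} → (∀ x → f x ≤ g x) → ∑ xs f ≤ ∑ xs g
    ∑-mono []       f≤g = z≤n
    ∑-mono (x ∷ xs) f≤g = +-mono-≤ (f≤g x) (∑-mono xs f≤g)

    ∑-cong : ∀ xs {f g : A → ℕ} → (∀ x → f x ≡ g x) → ∑ xs f ≡ ∑ xs g
    ∑-cong []       f≗g = refl
    ∑-cong (x ∷ xs) f≗g = cong₂ _+_ (f≗g x) (∑-cong xs f≗g)

    ∑-+ : ∀ xs (f g : A → ℕ) → ∑ xs (λ x → f x + g x) ≡ ∑ xs f + ∑ xs g
    ∑-+ []       f g = refl
    ∑-+ (x ∷ xs) f g rewrite ∑-+ xs f g = interchange (f x) (g x) (∑ xs f) (∑ xs g)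
      where
      interchange : ∀ a b c d → a + b + (c + d) ≡ a + c + (b + d)
      interchange = solve-∀

    ∑-const : ∀ xs c → ∑ xs (λ _ → c) ≡ length xs * c
    ∑-const []       c = refl
    ∑-const (x ∷ xs) c = cong (c +_) (∑-const xs c)

    ∑-zero : ∀ xs → ∑ xs (λ _ → 0) ≡ 0
    ∑-zero xs = trans (∑-const xs 0) (*-zeroʳ (length xs))

    ∑-*ʳ : ∀ xs (f : A → ℕ) c → ∑ xs (λ x → f x * c) ≡ ∑ xs f * c
    ∑-*ʳ []       f c = refl
    ∑-*ʳ (x ∷ xs) f c rewrite ∑-*ʳ xs f c = sym (*-distribʳ-+ c (f x) (∑ xs f))

    ∑-++ : ∀ xs ys (f : A → ℕ) → ∑ (xs ++ ys) f ≡ ∑ xs f + ∑ ys f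
    ∑-++ xs ys f = trans (cong sum (map-++ f xs ys)) (sum-++ (map f xs) (map f ys))

  ∑-swap : ∀ {A B : Set} (xs : List A) (ys : List B) (f : A → B → ℕ) →
    ∑ xs (λ x → ∑ ys (f x)) ≡ ∑ ys (λ y → ∑ xs (λ x → f x y))
  ∑-swap []       ys f = sym (∑-zero ys)
  ∑-swap (x ∷ xs) ys f = trans (cong (∑ ys (f x) +_) (∑-swap xs ys f))
    (sym (∑-+ ys (f x) (λ y → ∑ xs (λ x → f x y))))

  ∑-cartesianProductWith : ∀ {A B C : Set} (g : A → B → C) (xs : List A) (ys : List B) (f : C → ℕ) →
    ∑ (cartesianProductWith g xs ys) f ≡ ∑ xs (λ x → ∑ ys (λ y → f (g x y)))
  ∑-cartesianProductWith g []       ys f = refl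
  ∑-cartesianProductWith g (x ∷ xs) ys f =
    trans (∑-++ (map (g x) ys) (cartesianProductWith g xs ys) f)
      (cong₂ _+_ (cong sum (sym (map-∘ ys))) (∑-cartesianProductWith g xs ys f))

  ∑< : ℕ → (ℕ → ℕ) → ℕ
  ∑< k f = sum (applyUpTo f k)

  ∑<-term : ∀ k (f : ℕ → ℕ) {q} → q < k → f q ≤ ∑< k f
  ∑<-term (suc k) f {zero}  _         = m≤m+n (f 0) _
  ∑<-term (suc k) f {suc q} (s≤s q<k) = ≤-trans (∑<-term k (f ∘ suc) q<k) (m≤n+m _ (f 0))

  ∑<-bound : ∀ k (f : ℕ → ℕ) {c Y} → (∀ q → f q * c ≤ Y) → ∑< k f * c ≤ k * Y
  ∑<-bound zero    f h = z≤n
  ∑<-bound (suc k) f {c} h = ≤-trans (≤-reflexive (*-distribʳ-+ c (f 0) _))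
    (+-mono-≤ (h 0) (∑<-bound k (f ∘ suc) (h ∘ suc)))

  -- As `2 ≤ σ`, the first term takes at most half of the bound and, by induction at `suc e`, all
  -- others together at most the other half. So the number `k` of terms does not enter.
  ∑<-geometric : ∀ {σ} → 2 ≤ σ → ∀ k (f : ℕ → ℕ) e {Y} →
    (∀ q → f q * σ ^ (suc e + q) ≤ Y) → ∑< k f * σ ^ e ≤ Y
  ∑<-geometric 2≤σ zero    f e h = z≤n
  ∑<-geometric {σ} 2≤σ (suc k) f e {Y} h = *-cancelˡ-≤ 2 (begin
    2 * ((f 0 + rest) * σ ^ e)                   ≡⟨ expand (f 0) rest (σ ^ e) ⟩
    f 0 * (2 * σ ^ e) + rest * (2 * σ ^ e)       ≤⟨ +-mono-≤ (*-monoʳ-≤ (f 0) double)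
                                                      (*-monoʳ-≤ rest double) ⟩
    f 0 * σ ^ suc e + rest * σ ^ suc e           ≤⟨ +-mono-≤ first others ⟩
    Y + Y                                        ≡⟨ cong (Y +_) (+-identityʳ Y) ⟨
    2 * Y                                        ∎)
    where
    open ≤-Reasoning

    rest : ℕ
    rest = ∑< k (f ∘ suc)

    expand : ∀ a b c → 2 * ((a + b) * c) ≡ a * (2 * c) + b * (2 * c)
    expand = solve-∀

    double : 2 * σ ^ e ≤ σ ^ suc e
    double = *-monoˡ-≤ (σ ^ e) 2≤σ

    first : f 0 * σ ^ suc e ≤ Y
    first = subst (λ k → f 0 * σ ^ k ≤ Y) (+-identityʳ (suc e)) (h 0)

    others : rest * σ ^ suc e ≤ Y
    others = ∑<-geometric 2≤σ k (f ∘ suc) (suc e) λ q →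
      subst (λ k → f (suc q) * σ ^ k ≤ Y) (+-suc (suc e) q) (h (suc q))

  -- Sums over all strings

  δ : ∀ {σ} → Fin σ → Fin σ → ℕ
  δ zero    zero    = 1
  δ zero    (suc x) = 0
  δ (suc a) zero    = 0
  δ (suc a) (suc x) = δ a x

  ∑-δ : ∀ {σ} (a : Fin σ) → ∑ (allFin σ) (δ a) ≡ 1
  ∑-δ {suc σ} a = trans (cong (λ xs → δ a zero + sum (map (δ a) xs)) (sym (map-tabulate id suc)))
    (trans (cong (λ xs → δ a zero + sum xs) (sym (map-∘ (allFin σ)))) (split a))
    where
    split : ∀ a → δ a zero + ∑ (allFin σ) (δ a ∘ suc) ≡ 1
    split zero    = cong suc (∑-zero (allFin σ))
    split (suc a) = ∑-δ a

  δ-refl : ∀ {σ} (a : Fin σ) → δ a a ≡ 1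
  δ-refl zero    = refl
  δ-refl (suc a) = δ-refl a

  δ-positive⇒≡ : ∀ {σ} (a x : Fin σ) → 1 ≤ δ a x → a ≡ x
  δ-positive⇒≡ zero    zero    _ = refl
  δ-positive⇒≡ (suc a) (suc x) p = cong suc (δ-positive⇒≡ a x p)

  δ≤1 : ∀ {σ} (a x : Fin σ) → δ a x ≤ 1
  δ≤1 zero    zero    = ≤-refl
  δ≤1 zero    (suc x) = z≤n
  δ≤1 (suc a) zero    = z≤n
  δ≤1 (suc a) (suc x) = δ≤1 a x

  δ? : ∀ {σ} → Maybe (Fin σ) → Fin σ → ℕ
  δ? nothing  x = 0
  δ? (just a) x = δ a x

  ∑-δ?≤1 : ∀ {σ} (p : Maybe (Fin σ)) → ∑ (allFin σ) (δ? p) ≤ 1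
  ∑-δ?≤1 {σ} nothing  = ≤-trans (≤-reflexive (∑-zero (allFin σ))) z≤n
  ∑-δ?≤1     (just a) = ≤-reflexive (∑-δ a)

  length-allFin : ∀ σ → length (allFin σ) ≡ σ
  length-allFin σ = length-tabulate {n = σ} id

  skip : ∀ {A : Set} {n} m → Vec A n → Vec A (n ∸ m)
  skip zero    S       = S
  skip (suc m) []      = []
  skip (suc m) (x ∷ S) = skip m S

  letter-skip : ∀ {A : Set} {n} m (S : Vec A n) d → letter (skip m S) (suc d) ≡ letter S (m + suc d)
  letter-skip zero    S       d = refl
  letter-skip (suc m) []      d = refl
  letter-skip (suc m) (x ∷ S) d rewrite +-suc m d =
    trans (letter-skip m S d) (cong (letter S) (+-suc m d))

  module _ {σ : ℕ} where

    total : ∀ n → (Vec (Fin σ) n → ℕ) → ℕ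
    total n f = ∑ (allStrings σ n) f

    total-suc : ∀ n f → total (suc n) f ≡ ∑ (allFin σ) (λ x → total n (λ S → f (x ∷ S)))
    total-suc n f = ∑-cartesianProductWith _∷_ (allFin σ) (allStrings σ n) f

    total-tail : ∀ n f → total (suc n) (λ { (_ ∷ S) → f S }) ≡ σ * total n f
    total-tail n f = trans (total-suc n _)
      (trans (∑-const (allFin σ) (total n f)) (cong (_* total n f) (length-allFin σ)))

    total-const : ∀ n c → total n (λ _ → c) ≡ σ ^ n * c
    total-const zero    c = refl
    total-const (suc n) c = trans (total-suc n _) (trans (∑-const (allFin σ) _)
      (trans (cong₂ _*_ (length-allFin σ) (total-const n c)) (sym (*-assoc σ (σ ^ n) c))))

    total-∑< : ∀ n k (h : ℕ → Vec (Fin σ) n → ℕ) →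
      total n (λ S → ∑< k (λ q → h q S)) ≡ ∑< k (λ q → total n (h q))
    total-∑< n zero    h = trans (total-const n 0) (*-zeroʳ (σ ^ n))
    total-∑< n (suc k) h = trans (∑-+ (allStrings σ n) (h 0) (λ S → ∑< k (λ q → h (suc q) S)))
      (cong (total n (h 0) +_) (total-∑< n k (h ∘ suc)))

    -- Letters predicted from the right

    Predictor : Set
    Predictor = ∀ {k} → Vec (Fin σ) k → Maybe (Fin σ)

    -- 1 if each of the b letters after the first i is the one that g predicts from the letters
    -- to its right, and 0 otherwise.
    predicted : Predictor → ℕ → ℕ → ∀ {n} → Vec (Fin σ) n → ℕ
    predicted g zero    zero    S       = 1
    predicted g zero    (suc b) []      = 0
    predicted g zero    (suc b) (x ∷ S) = δ? (g S) x * predicted g zero b S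
    predicted g (suc i) b       []      = 0
    predicted g (suc i) b       (x ∷ S) = predicted g i b S

    -- For each fixed tail at most one letter in front of it matches, since `g` sees only the tail;
    -- so each predicted letter costs a factor `σ`, even where the predictions depend on one
    -- another, as for a border that overlaps itself. A constant `g` gives runs, the letter at a
    -- fixed distance gives borders.
    total-predicted : ∀ (g : Predictor) i b n → total n (predicted g i b) * σ ^ b ≤ σ ^ n
    total-predicted g zero zero n =
      ≤-reflexive (trans (*-identityʳ _) (trans (total-const n 1) (*-identityʳ _)))
    total-predicted g zero (suc b) zero = z≤n
    total-predicted g zero (suc b) (suc n) = begin
      total (suc n) (predicted g zero (suc b)) * (σ * σ ^ b) ≤⟨ *-monoˡ-≤ (σ * σ ^ b) drop-letter ⟩
      X * (σ * σ ^ b)                                        ≡⟨ swap X σ (σ ^ b) ⟩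
      σ * (X * σ ^ b)                                        ≤⟨ *-monoʳ-≤ σ (total-predicted g zero b n) ⟩
      σ * σ ^ n                                              ∎
      where
      open ≤-Reasoning

      X : ℕ
      X = total n (predicted g zero b)

      swap : ∀ a b c → a * (b * c) ≡ b * (a * c)
      swap = solve-∀

      drop-letter : total (suc n) (predicted g zero (suc b)) ≤ X
      drop-letter = begin
        total (suc n) (predicted g zero (suc b))
          ≡⟨ total-suc n _ ⟩
        ∑ (allFin σ) (λ x → total n (λ S → δ? (g S) x * predicted g zero b S))
          ≡⟨ ∑-swap (allFin σ) (allStrings σ n) _ ⟩
        total n (λ S → ∑ (allFin σ) (λ x → δ? (g S) x * predicted g zero b S))
          ≤⟨ ∑-mono (allStrings σ n) (λ S → ≤-trans
               (≤-reflexive (∑-*ʳ (allFin σ) (δ? (g S)) (predicted g zero b S)))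
               (≤-trans (*-monoˡ-≤ (predicted g zero b S) (∑-δ?≤1 (g S)))
                 (≤-reflexive (+-identityʳ _)))) ⟩
        X ∎
    total-predicted g (suc i) b zero = z≤n
    total-predicted g (suc i) b (suc n) = begin
      total (suc n) (predicted g (suc i) b) * σ ^ b ≡⟨ cong (_* σ ^ b) drop-letter ⟩
      σ * total n (predicted g i b) * σ ^ b         ≡⟨ *-assoc σ _ (σ ^ b) ⟩
      σ * (total n (predicted g i b) * σ ^ b)       ≤⟨ *-monoʳ-≤ σ (total-predicted g i b n) ⟩
      σ * σ ^ n                                     ∎
      where
      open ≤-Reasoning

      drop-letter : total (suc n) (predicted g (suc i) b) ≡ σ * total n (predicted g i b)
      drop-letter = trans (∑-cong (allStrings σ (suc n)) λ { (x ∷ S) → refl })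
        (total-tail n (predicted g i b))

    predicted-positive : ∀ (g : Predictor) i b {n} (S : Vec (Fin σ) n) → i ≤ n →
      (∀ {x} → x < b → ∃ λ a → letter S (suc (i + x)) ≡ just a × g (skip (suc (i + x)) S) ≡ just a) →
      1 ≤ predicted g i b S
    predicted-positive g zero zero S _ h = ≤-refl
    predicted-positive g zero (suc b) [] _ h with () ← proj₁ (proj₂ (h {0} (s≤s z≤n)))
    predicted-positive g zero (suc b) (x ∷ S) _ h with h {0} (s≤s z≤n)
    ... | a , refl , g≡ = *-mono-≤ (≤-reflexive (sym (trans (cong (λ p → δ? p x) g≡) (δ-refl x))))
            (predicted-positive g zero b S z≤n (λ x<b → h (s≤s x<b)))
    predicted-positive g (suc i) b (x ∷ S) (s≤s i≤n) h = predicted-positive g i b S i≤n h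

    -- Runs of a letter in disjoint blocks

    run : Fin σ → ℕ → ∀ {n} → Vec (Fin σ) n → ℕ
    run a = predicted (λ _ → just a) 0

    run≤1 : ∀ a m {n} (S : Vec (Fin σ) n) → run a m S ≤ 1
    run≤1 a zero    S       = ≤-refl
    run≤1 a (suc m) []      = z≤n
    run≤1 a (suc m) (x ∷ S) = *-mono-≤ (δ≤1 a x) (run≤1 a m S)

    run-letters : ∀ a m {n} (S : Vec (Fin σ) n) → 1 ≤ run a m S →
      ∀ {x} → x < m → letter S (suc x) ≡ just a
    run-letters a (suc m) (x ∷ S) p {k} k<m with δ a x in δ≡ | run a m S in run≡
    ... | suc u | suc v = found k<m
      where
      found : ∀ {k} → k < suc m → letter (x ∷ S) (suc k) ≡ just a
      found {zero}  _         = cong just (sym (δ-positive⇒≡ a x (subst (1 ≤_) (sym δ≡) (s≤s z≤n))))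
      found {suc k} (s≤s k<m) = run-letters a m S (subst (1 ≤_) (sym run≡) (s≤s z≤n)) k<m
    ... | suc u | zero  = ⊥-elim (n≮0 (subst (1 ≤_) (*-zeroʳ u) p))

    -- Only runs that fill one of `r` consecutive blocks are considered: the blocks are disjoint, so
    -- the count factors exactly.
    avoids : Fin σ → ℕ → ℕ → ∀ {n} → Vec (Fin σ) n → ℕ
    avoids a m zero    S = 1
    avoids a m (suc r) S = (1 ∸ run a m S) * avoids a m r (skip m S)

    total-skip : ∀ {n m} (f : Vec (Fin σ) (n ∸ m) → ℕ) → m ≤ n →
      total n (f ∘ skip m) ≡ σ ^ m * total (n ∸ m) f
    total-skip {n}     f z≤n       = sym (+-identityʳ _)
    total-skip {suc n} {suc m} f (s≤s m≤n) =
      trans (∑-cong (allStrings σ (suc n)) λ { (x ∷ S) → refl }) (trans (total-tail n (f ∘ skip m))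
      (trans (cong (σ *_) (total-skip f m≤n)) (sym (*-assoc σ (σ ^ m) _))))

    total-run-skip : ∀ a {n m} (f : Vec (Fin σ) (n ∸ m) → ℕ) → m ≤ n →
      total n (λ S → run a m S * f (skip m S)) ≡ total (n ∸ m) f
    total-run-skip a {n} f z≤n = ∑-cong (allStrings σ n) λ S → +-identityʳ (f S)
    total-run-skip a {suc n} {suc m} f (s≤s m≤n) = begin
      total (suc n) (λ S → run a (suc m) S * f (skip (suc m) S))
        ≡⟨ total-suc n _ ⟩
      ∑ (allFin σ) (λ x → total n (λ S → δ a x * run a m S * f (skip m S)))
        ≡⟨ ∑-swap (allFin σ) (allStrings σ n) _ ⟩
      total n (λ S → ∑ (allFin σ) (λ x → δ a x * run a m S * f (skip m S)))
        ≡⟨ ∑-cong (allStrings σ n) (λ S → trans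
             (∑-cong (allFin σ) (λ x → *-assoc (δ a x) (run a m S) (f (skip m S))))
             (trans (∑-*ʳ (allFin σ) (δ a) (run a m S * f (skip m S)))
               (trans (cong (_* (run a m S * f (skip m S))) (∑-δ a)) (+-identityʳ _)))) ⟩
      total n (λ S → run a m S * f (skip m S))
        ≡⟨ total-run-skip a f m≤n ⟩
      total (n ∸ m) f ∎
      where open ≡-Reasoning

    -- By complement: of the `suc D` possible first blocks exactly one is the run. Adding the
    -- strings that begin with it, `T` in number, removes the condition on the first block.
    total-avoids-suc : ∀ a m r n {D} → σ ^ m ≡ suc D → m ≤ n →
      total n (avoids a m (suc r)) ≡ D * total (n ∸ m) (avoids a m r)
    total-avoids-suc a m r n {D} σ^m≡ m≤n = +-cancelʳ-≡ T _ (D * T) (begin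
      total n (avoids a m (suc r)) + T
        ≡⟨ cong (total n (avoids a m (suc r)) +_) (total-run-skip a (avoids a m r) m≤n) ⟨
      total n (avoids a m (suc r)) + total n (λ S → run a m S * avoids a m r (skip m S))
        ≡⟨ ∑-+ (allStrings σ n) (avoids a m (suc r)) _ ⟨
      total n (λ S → (1 ∸ run a m S) * avoids a m r (skip m S) + run a m S * avoids a m r (skip m S))
        ≡⟨ ∑-cong (allStrings σ n) (λ S → trans
             (sym (*-distribʳ-+ (avoids a m r (skip m S)) (1 ∸ run a m S) (run a m S)))
             (trans (cong (_* avoids a m r (skip m S)) (m∸n+n≡m (run≤1 a m S))) (+-identityʳ _))) ⟩
      total n (avoids a m r ∘ skip m)
        ≡⟨ total-skip (avoids a m r) m≤n ⟩
      σ ^ m * T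
        ≡⟨ cong (_* T) σ^m≡ ⟩
      T + D * T
        ≡⟨ +-comm T (D * T) ⟩
      D * T + T ∎)
      where
      open ≡-Reasoning

      T : ℕ
      T = total (n ∸ m) (avoids a m r)

    -- The probability `(1 − 1/σ ^ m) ^ r`, cross-multiplied.
    total-avoids : ∀ a m r n {D} → σ ^ m ≡ suc D → r * m ≤ n →
      total n (avoids a m r) * suc D ^ r ≡ D ^ r * σ ^ n
    total-avoids a m zero    n     σ^m≡ _ =
      trans (*-identityʳ _) (trans (total-const n 1) (trans (*-identityʳ _) (sym (+-identityʳ _))))
    total-avoids a m (suc r) n {D} σ^m≡ m+rm≤n = begin
      total n (avoids a m (suc r)) * (suc D * suc D ^ r)
        ≡⟨ cong (_* (suc D * suc D ^ r)) (total-avoids-suc a m r n σ^m≡ m≤n) ⟩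
      D * T * (suc D * suc D ^ r)
        ≡⟨ swap D T (suc D) (suc D ^ r) ⟩
      D * suc D * (T * suc D ^ r)
        ≡⟨ cong (D * suc D *_) (total-avoids a m r (n ∸ m) σ^m≡ rm≤) ⟩
      D * suc D * (D ^ r * σ ^ (n ∸ m))
        ≡⟨ swap D (D ^ r) (suc D) (σ ^ (n ∸ m)) ⟨
      D * D ^ r * (suc D * σ ^ (n ∸ m))
        ≡⟨ cong (λ M → D * D ^ r * (M * σ ^ (n ∸ m))) σ^m≡ ⟨
      D * D ^ r * (σ ^ m * σ ^ (n ∸ m))
        ≡⟨ cong (D * D ^ r *_)
             (trans (sym (^-distribˡ-+-* σ m (n ∸ m))) (cong (σ ^_) (m+[n∸m]≡n m≤n))) ⟩
      D * D ^ r * σ ^ n ∎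
      where
      open ≡-Reasoning

      T : ℕ
      T = total (n ∸ m) (avoids a m r)

      m≤n : m ≤ n
      m≤n = m+n≤o⇒m≤o m m+rm≤n

      rm≤ : r * m ≤ n ∸ m
      rm≤ = m+n≤o⇒m≤o∸n (r * m) (≤-trans (≤-reflexive (+-comm (r * m) m)) m+rm≤n)

      swap : ∀ a b c d → a * b * (c * d) ≡ a * c * (b * d)
      swap = solve-∀

    avoids-zero : ∀ a m r {n} (S : Vec (Fin σ) n) → avoids a m r S ≡ 0 →
      ∃ λ i → i + m ≤ r * m × (∀ {x} → x < m → letter S (suc (i + x)) ≡ just a)
    avoids-zero a m (suc r) S p with m*n≡0⇒m≡0∨n≡0 (1 ∸ run a m S) p
    ... | inj₁ no-gap = 0 , m≤m+n m (r * m) , run-letters a m S (m∸n≡0⇒m≤n no-gap)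
    ... | inj₂ later with avoids-zero a m r (skip m S) later
    ...   | i , i+m≤ , letters = m + i , ≤-trans (≤-reflexive (+-assoc m i m)) (+-monoʳ-≤ m i+m≤) ,
            λ {x} x<m → trans
              (cong (letter S) (trans (cong suc (+-assoc m i x)) (sym (+-suc m (i + x)))))
              (trans (sym (letter-skip m S (i + x))) (letters x<m))

  -- Bernoulli's inequality `(1 + 1/D) ^ r ≥ 1 + r/D` with denominators cleared.
  bernoulli : ∀ D r → D ^ r * (D + r) ≤ suc D ^ r * D
  bernoulli D zero    = ≤-reflexive (cong (1 *_) (+-identityʳ D))
  bernoulli D (suc r) = begin
    D * D ^ r * (D + suc r)           ≡⟨ *-assoc D (D ^ r) (D + suc r) ⟩
    D * (D ^ r * (D + suc r))         ≡⟨ expand D (D ^ r) r ⟩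
    D ^ r * (D * (D + suc r))         ≤⟨ *-monoʳ-≤ (D ^ r)
                                           (≤-trans (m≤m+n _ r) (≤-reflexive (cross D r))) ⟩
    D ^ r * (suc D * (D + r))         ≡⟨ swap (D ^ r) (suc D) (D + r) ⟩
    suc D * (D ^ r * (D + r))         ≤⟨ *-monoʳ-≤ (suc D) (bernoulli D r) ⟩
    suc D * (suc D ^ r * D)           ≡⟨ *-assoc (suc D) (suc D ^ r) D ⟨
    suc D * suc D ^ r * D             ∎
    where
    open ≤-Reasoning

    expand : ∀ D X r → D * (X * (D + suc r)) ≡ X * (D * (D + suc r))
    expand = solve-∀

    cross : ∀ D r → D * (D + suc r) + r ≡ suc D * (D + r)
    cross = solve-∀

    swap : ∀ a b c → a * (b * c) ≡ b * (a * c)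
    swap = solve-∀

  -- Exceptional strings

  *-cancel-bound : ∀ X c {Y Z M} .{{_ : NonZero M}} → X * M ≤ c * Y → c * Z ≤ M → X * Z ≤ Y
  *-cancel-bound X c {Y} {Z} {M} XM≤cY cZ≤M = *-cancelʳ-≤ (X * Z) Y M (begin
    X * Z * M   ≡⟨ swap X Z M ⟩
    X * M * Z   ≤⟨ *-monoˡ-≤ Z XM≤cY ⟩
    c * Y * Z   ≡⟨ swap′ c Y Z ⟩
    Y * (c * Z) ≤⟨ *-monoʳ-≤ Y cZ≤M ⟩
    Y * M       ∎)
    where
    open ≤-Reasoning

    swap : ∀ a b c → a * b * c ≡ a * c * b
    swap = solve-∀

    swap′ : ∀ a b c → a * b * c ≡ b * (a * c)
    swap′ = solve-∀

  module _ {σ : ℕ} (m : ℕ) where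

    -- The run that would end at `S[n]`, the case `q = m`, is left out: it cannot occur when `S[n]`
    -- differs from `a`.
    tailRuns : Fin σ → ∀ {n} → Vec (Fin σ) n → ℕ
    tailRuns a {n} S = ∑< m λ q → predicted (λ _ → just a) (n ∸ (m + m) + q) m S

    -- The prediction letter T d expresses the equality of letters at distance d.
    longBorders : ℕ → ∀ {n} → Vec (Fin σ) n → ℕ
    longBorders k {n} S = ∑< k λ i → ∑< n λ q →
      predicted (λ T → letter T (n ∸ i ∸ (suc (m + m) + q))) i (suc (m + m) + q) S

    total-tailRuns : ∀ a n → total n (tailRuns a) * σ ^ m ≤ m * σ ^ n
    total-tailRuns a n = ≤-trans
      (≤-reflexive (cong (_* σ ^ m) (total-∑< n m λ q → predicted (λ _ → just a) (n ∸ (m + m) + q) m)))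
      (∑<-bound m _ λ q → total-predicted (λ _ → just a) (n ∸ (m + m) + q) m n)

    -- For each start the probabilities `1/σ ^ b` over all lengths `b > m + m` form a geometric
    -- series of sum at most `1/σ ^ (m + m)`; only the `k` starts are paid for.
    total-longBorders : 2 ≤ σ → ∀ k n → total n (longBorders k) * σ ^ (m + m) ≤ k * σ ^ n
    total-longBorders 2≤σ k n = ≤-trans
      (≤-reflexive (cong (_* σ ^ (m + m)) (total-∑< n k λ i S → ∑< n λ q → border i q S)))
      (∑<-bound k _ λ i → ≤-trans
        (≤-reflexive (cong (_* σ ^ (m + m)) (total-∑< n n (border i))))
        (∑<-geometric 2≤σ n _ (m + m) λ q →
          total-predicted (λ T → letter T (n ∸ i ∸ (suc (m + m) + q))) i (suc (m + m) + q) n))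
      where
      border : ℕ → ℕ → Vec (Fin σ) n → ℕ
      border i q = predicted (λ T → letter T (n ∸ i ∸ (suc (m + m) + q))) i (suc (m + m) + q)

    -- With `suc D = σ ^ m` and `r = suc D * R`, Bernoulli bounds the probability `(D / suc D) ^ r`
    -- by `D / (D + r)`, which is at most `suc D / r = 1/R`. This decay is weaker than exponential
    -- but suffices.
    total-avoids-≤ : .{{_ : NonZero σ}} → ∀ a R n → σ ^ m * R * m ≤ n →
      total n (avoids a m (σ ^ m * R)) * R ≤ σ ^ n
    total-avoids-≤ a R n rm≤n with σ ^ m in σ^m≡ | m^n>0 σ m
    ... | suc D | _ = *-cancelˡ-≤ (suc D) (*-cancelʳ-≤ _ _ (suc D ^ r) {{m^n≢0 (suc D) r}} (begin
      suc D * (X * R) * suc D ^ r   ≡⟨ swap (suc D) X R (suc D ^ r) ⟩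
      X * suc D ^ r * r             ≡⟨ cong (_* r) (total-avoids a m r n σ^m≡ rm≤n) ⟩
      D ^ r * σ ^ n * r             ≡⟨ swap′ (D ^ r) (σ ^ n) r ⟩
      D ^ r * r * σ ^ n             ≤⟨ *-monoˡ-≤ (σ ^ n) (*-monoʳ-≤ (D ^ r) (m≤n+m r D)) ⟩
      D ^ r * (D + r) * σ ^ n       ≤⟨ *-monoˡ-≤ (σ ^ n) (bernoulli D r) ⟩
      suc D ^ r * D * σ ^ n         ≤⟨ *-monoˡ-≤ (σ ^ n) (*-monoʳ-≤ (suc D ^ r) (n≤1+n D)) ⟩
      suc D ^ r * suc D * σ ^ n     ≡⟨ swap″ (suc D ^ r) (suc D) (σ ^ n) ⟩
      suc D * σ ^ n * suc D ^ r     ∎))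
      where
      open ≤-Reasoning

      r X : ℕ
      r = suc D * R
      X = total n (avoids a m r)

      swap : ∀ M X R P → M * (X * R) * P ≡ X * P * (M * R)
      swap = solve-∀

      swap′ : ∀ a b c → a * b * c ≡ a * c * b
      swap′ = solve-∀

      swap″ : ∀ a b c → a * b * c ≡ b * c * a
      swap″ = solve-∀

    noBorder-from-run : ∀ {n} (S : Vec (Fin σ) n) a {i y k} → suc i + y ≡ n → i < k → m + m ≤ n →
      (∀ {x} → x < m → letter S (suc (i + x)) ≡ just a) → letter S n ≢ just a →
      tailRuns a S ≡ 0 → longBorders k S ≡ 0 → NoBorder (from S (suc i)) (suc y)
    noBorder-from-run {n} S a {i} {y} {k} end i<k 2m≤n start Sₙ≢a noTail noLong {b} (d , d+b , agree)
      with <-≤-connex b m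
    ... | inj₁ b<m = Sₙ≢a (begin
        letter S n                      ≡⟨ cong (letter S) end ⟨
        letter S (suc i + y)            ≡⟨ cong (λ z → letter S (suc i + z))
                                             (suc-injective (trans (sym (+-suc (suc d) b)) d+b)) ⟨
        letter S (suc i + (suc d + b))  ≡⟨ agree ≤-refl ⟨
        letter S (suc (i + b))          ≡⟨ start b<m ⟩
        just a                          ∎)
      where open ≡-Reasoning
    ... | inj₂ m≤b with ≤-<-connex (suc b) (m + m)
    ...   | inj₁ b≤2m = n≮0 (subst (1 ≤_) noTail
            (≤-trans positive (∑<-term m (λ q → predicted (λ _ → just a) (n ∸ (m + m) + q) m S) q<m)))
      where
      p+b : i + suc d + suc b ≡ n
      p+b = trans (+-assoc i (suc d) (suc b)) (trans (cong (i +_) d+b) (trans (+-suc i y) end))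

      -- The border has length `suc b`, so its right occurrence begins after `n ∸ suc b` letters,
      -- which is `q` more than `n ∸ (m + m)`; `m ≤ b` yields `q < m`.
      q : ℕ
      q = m + m ∸ suc b

      q<m : q < m
      q<m = +-cancelʳ-< (suc b) q m (≤-trans
        (≤-reflexive (cong suc (m∸n+n≡m b≤2m)))
        (≤-trans (s≤s (+-monoʳ-≤ m m≤b)) (≤-reflexive (sym (+-suc m b)))))

      p≡ : n ∸ (m + m) + q ≡ i + suc d
      p≡ = +-cancelʳ-≡ (suc b) _ _ (trans (+-assoc _ q (suc b))
        (trans (cong (n ∸ (m + m) +_) (m∸n+n≡m b≤2m)) (trans (m∸n+n≡m 2m≤n) (sym p+b))))

      letters : ∀ {x} → x < m → letter S (suc (i + suc d + x)) ≡ just a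
      letters {x} x<m = trans (cong (letter S) (cong suc (+-assoc i (suc d) x)))
        (trans (sym (agree (≤-trans x<m (m≤n⇒m≤1+n m≤b)))) (start x<m))

      positive : 1 ≤ predicted (λ _ → just a) (n ∸ (m + m) + q) m S
      positive = subst (λ p → 1 ≤ predicted (λ _ → just a) p m S) (sym p≡)
        (predicted-positive (λ _ → just a) (i + suc d) m S
          (≤-trans (m≤m+n (i + suc d) (suc b)) (≤-reflexive p+b))
          λ x<m → a , letters x<m , refl)
    ...   | inj₂ 2m<b with m≤n⇒∃[o]m+o≡n 2m<b
    ...     | q , 2m+q≡b = n≮0 (subst (1 ≤_) noLong (≤-trans positive (≤-trans
                (∑<-term n _ q<n)
                (∑<-term k (λ i → ∑< n λ q →
                  predicted (λ T → letter T (n ∸ i ∸ (suc (m + m) + q))) i (suc (m + m) + q) S) i<k))))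
      where
      n∸i : n ∸ i ≡ suc d + suc b
      n∸i = trans (cong (_∸ i) (trans (sym end) (sym (+-suc i y))))
        (trans (m+n∸m≡n i (suc y)) (sym d+b))

      -- The two occurrences of a border of the suffix are as far apart as its period, which is the
      -- suffix length minus the border length.
      distance : n ∸ i ∸ (suc (m + m) + q) ≡ suc d
      distance = trans (cong₂ _∸_ n∸i 2m+q≡b) (m+n∸n≡m (suc d) (suc b))

      b≤y : suc b ≤ y
      b≤y = s≤s⁻¹ (≤-trans (s≤s (m≤n+m (suc b) d)) (≤-reflexive d+b))

      q<n : q < n
      q<n = ≤-trans (s≤s (≤-trans (m≤n+m q (suc (m + m))) (≤-trans (≤-reflexive 2m+q≡b)
        (≤-trans b≤y (m≤n+m y i))))) (≤-reflexive end)

      letters : ∀ {x} → x < suc b → ∃ λ c → letter S (suc (i + x)) ≡ just c ×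
        letter (skip (suc (i + x)) S) (suc d) ≡ just c
      letters {x} x<b with letter-defined S {suc (i + x)} (s≤s z≤n)
        (≤-trans (s≤s (+-monoʳ-≤ i (≤-trans (<⇒≤ x<b) b≤y))) (≤-reflexive end))
      ... | c , c≡ = c , c≡ , (begin
          letter (skip (suc (i + x)) S) (suc d) ≡⟨ letter-skip (suc (i + x)) S d ⟩
          letter S (suc (i + x) + suc d)        ≡⟨ cong (letter S) (rearrange i x d) ⟩
          letter S (suc i + (suc d + x))        ≡⟨ agree x<b ⟨
          letter S (suc i + x)                  ≡⟨ c≡ ⟩
          just c                                ∎)
        where
        open ≡-Reasoning

        rearrange : ∀ i x d → suc (i + x) + suc d ≡ suc i + (suc d + x)
        rearrange = solve-∀

      positive : 1 ≤ predicted (λ T → letter T (n ∸ i ∸ (suc (m + m) + q))) i (suc (m + m) + q) S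
      positive rewrite distance | 2m+q≡b = predicted-positive (λ T → letter T (suc d)) i (suc b) S
        (≤-trans (m≤m+n i (suc y)) (≤-reflexive (trans (+-suc i y) end))) letters

    -- A sum of five failure counts that vanishes only if none of the failures occurs. Both letters
    -- are included because which of them differs from `S[n]` depends on `S`.
    exceptional : Fin σ → Fin σ → ℕ → ∀ {n} → Vec (Fin σ) n → ℕ
    exceptional a a′ r S =
      avoids a m r S + avoids a′ m r S + (tailRuns a S + tailRuns a′ S + longBorders (r * m) S)

    unexceptional : ∀ {n} (S : Vec (Fin σ) n) {a a′} r →
      a ≢ a′ → 1 ≤ m → 1 ≤ n → m + m ≤ n → r * m ≤ n →
      exceptional a a′ r S ≡ 0 →
      ∃₂ λ i y → i < r * m × suc i + y ≡ n × NoBorder (from S (suc i)) (suc y)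
    unexceptional {n} S {a} {a′} r a≢a′ 1≤m 1≤n 2m≤n rm≤n none =
      choose (letter-defined S 1≤n ≤-refl)
      where
      A₀ A₁ T₀ T₁ L : ℕ
      A₀ = avoids a m r S
      A₁ = avoids a′ m r S
      T₀ = tailRuns a S
      T₁ = tailRuns a′ S
      L  = longBorders (r * m) S

      A≡0 : A₀ + A₁ ≡ 0
      A≡0 = m+n≡0⇒m≡0 (A₀ + A₁) none

      TL≡0 : T₀ + T₁ + L ≡ 0
      TL≡0 = m+n≡0⇒n≡0 (A₀ + A₁) none

      T≡0 : T₀ + T₁ ≡ 0
      T≡0 = m+n≡0⇒m≡0 (T₀ + T₁) TL≡0

      build : ∀ c → letter S n ≢ just c → avoids c m r S ≡ 0 → tailRuns c S ≡ 0 →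
        ∃₂ λ i y → i < r * m × suc i + y ≡ n × NoBorder (from S (suc i)) (suc y)
      build c Sₙ≢c A≡0 T≡0 with avoids-zero c m r S A≡0
      ... | i , i+m≤ , start with ≤-trans (≤-trans (≤-reflexive (+-comm 1 i)) (+-monoʳ-≤ i 1≤m)) i+m≤
      ...   | i<k with m≤n⇒∃[o]m+o≡n (≤-trans i<k rm≤n)
      ...     | y , end = i , y , i<k , end ,
                noBorder-from-run S c end i<k 2m≤n start Sₙ≢c T≡0 (m+n≡0⇒n≡0 (T₀ + T₁) TL≡0)

      choose : (∃ λ x → letter S n ≡ just x) →
        ∃₂ λ i y → i < r * m × suc i + y ≡ n × NoBorder (from S (suc i)) (suc y)
      choose (x , Sₙ≡x) with x ≟ᶠ a
      ... | yes refl = build a′ (λ Sₙ≡a′ → a≢a′ (just-injective (trans (sym Sₙ≡x) Sₙ≡a′)))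
                         (m+n≡0⇒n≡0 A₀ A≡0) (m+n≡0⇒n≡0 T₀ T≡0)
      ... | no x≢a   = build a (λ Sₙ≡a → x≢a (just-injective (trans (sym Sₙ≡x) Sₙ≡a)))
                         (m+n≡0⇒m≡0 A₀ A≡0) (m+n≡0⇒m≡0 T₀ T≡0)

    -- Each of the five failures has weight at most `1/Z`. The hypothesis on `Z` is what the long
    -- borders demand, as their bound is `m * Z / σ ^ m`; for the tail runs, with bound `m / σ ^ m`,
    -- the weaker `mZ≤` is enough.
    total-exceptional : .{{_ : NonZero σ}} → 2 ≤ σ → ∀ Z → m * (Z * Z) ≤ σ ^ m → ∀ a a′ n →
      σ ^ m * Z * m ≤ n → total n (exceptional a a′ (σ ^ m * Z)) * Z ≤ 5 * σ ^ n
    total-exceptional 2≤σ Z mZZ≤ a a′ n rm≤n = begin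
      total n (exceptional a a′ r) * Z
        ≡⟨ cong (_* Z) split ⟩
      (A a + A a′ + (T a + T a′ + L)) * Z
        ≡⟨ distribute (A a) (A a′) (T a) (T a′) L Z ⟩
      A a * Z + (A a′ * Z + (T a * Z + (T a′ * Z + (L * Z + 0))))
        ≤⟨ +-mono-≤ (total-avoids-≤ a Z n rm≤n) (+-mono-≤ (total-avoids-≤ a′ Z n rm≤n)
             (+-mono-≤ (tails a) (+-mono-≤ (tails a′) (+-monoˡ-≤ 0 long)))) ⟩
      5 * σ ^ n ∎
      where
      open ≤-Reasoning

      instance
        σ^m≢0 : NonZero (σ ^ m)
        σ^m≢0 = m^n≢0 σ m

      r : ℕ
      r = σ ^ m * Z

      A T : Fin σ → ℕ
      A c = total n (avoids c m r)
      T c = total n (tailRuns c)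

      L : ℕ
      L = total n (longBorders (r * m))

      split : total n (exceptional a a′ r) ≡ A a + A a′ + (T a + T a′ + L)
      split = trans (∑-+ (allStrings σ n) (λ S → avoids a m r S + avoids a′ m r S) _)
        (cong₂ _+_ (∑-+ (allStrings σ n) (avoids a m r) (avoids a′ m r))
          (trans (∑-+ (allStrings σ n) (λ S → tailRuns a S + tailRuns a′ S) (longBorders (r * m)))
            (cong (_+ L) (∑-+ (allStrings σ n) (tailRuns a) (tailRuns a′)))))

      distribute : ∀ a b c d e z →
        (a + b + (c + d + e)) * z ≡ a * z + (b * z + (c * z + (d * z + (e * z + 0))))
      distribute = solve-∀

      mZ≤ : ∀ Z → m * (Z * Z) ≤ σ ^ m → m * Z ≤ σ ^ m
      mZ≤ zero    _   = ≤-trans (≤-reflexive (*-zeroʳ m)) z≤n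
      mZ≤ (suc Z) mZZ = ≤-trans (*-monoʳ-≤ m (m≤m*n (suc Z) (suc Z))) mZZ

      tails : ∀ c → T c * Z ≤ σ ^ n
      tails c = *-cancel-bound (T c) m (total-tailRuns c n) (mZ≤ Z mZZ≤)

      long : L * Z ≤ σ ^ n
      long = *-cancel-bound L (r * m) {{m^n≢0 σ (m + m)}} (total-longBorders 2≤σ (r * m) n) (begin
        σ ^ m * Z * m * Z     ≡⟨ rearrange (σ ^ m) Z m ⟩
        σ ^ m * (m * (Z * Z)) ≤⟨ *-monoʳ-≤ (σ ^ m) mZZ≤ ⟩
        σ ^ m * σ ^ m         ≡⟨ ^-distribˡ-+-* σ m m ⟨
        σ ^ (m + m)           ∎)
        where
        rearrange : ∀ M Z m → M * Z * m * Z ≡ M * (m * (Z * Z))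
        rearrange = solve-∀

  -- The average running time

  -- The step count is read off the derivation that exists for every non-empty string; the value 0
  -- for the empty string is a mere default.
  runningTime : {σ n : ℕ} → Vec (Fin σ) n → ℕ
  runningTime {n = zero}  S = 0
  runningTime {n = suc n} S = Solves.time (solves-always S (s≤s z≤n))

  runningTime-≤ : ∀ {σ n} (S : Vec (Fin σ) n) → runningTime S ≤ 22 * (n * n)
  runningTime-≤ {n = zero}  S = z≤n
  runningTime-≤ {n = suc n} S = Solves.time≤ (solves-always S (s≤s z≤n))

  runningTime-≤-within : ∀ {σ n} (S : Vec (Fin σ) n) k {i y} →
    i < k → Occurs S i y → n ≤ suc y + k → runningTime S ≤ 22 * (n * k)
  runningTime-≤-within {n = zero}  S k _   _   _  = z≤n
  runningTime-≤-within {n = suc n} S k i<k occ n≤ =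
    subst (_≤ 22 * (suc n * k))
      (haltsFrom-deterministic (Solves.halts fast) (Solves.halts (solves-always S (s≤s z≤n))))
      (Solves.time≤ fast)
    where
    fast : Solves S initial (22 * (suc n * k))
    fast = solves-within S k i<k occ n≤ (s≤s z≤n)

  total-runningTime : ∀ {σ} .{{_ : NonZero σ}} m → 1 ≤ m → 2 ≤ σ → ∀ Z → m * (Z * Z) ≤ σ ^ m →
    {a a′ : Fin σ} → a ≢ a′ → let k = σ ^ m * Z * m in
    ∀ n → 1 ≤ n → m + m ≤ n → k ≤ n → k * Z ≤ n →
    total {σ} n runningTime * Z ≤ 132 * (n * n) * σ ^ n
  total-runningTime {σ} m 1≤m 2≤σ Z mZZ≤ {a} {a′} a≢a′ n 1≤n 2m≤n k≤n kZ≤n = begin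
    total {σ} n runningTime * Z
      ≤⟨ *-monoˡ-≤ Z (∑-mono (allStrings σ n) pointwise) ⟩
    total n (λ S → 22 * (n * k) + E S * (22 * (n * n))) * Z
      ≡⟨ cong (_* Z) (trans (∑-+ (allStrings σ n) (λ _ → 22 * (n * k)) _)
           (cong₂ _+_ (total-const n _) (∑-*ʳ (allStrings σ n) E (22 * (n * n))))) ⟩
    (σ ^ n * (22 * (n * k)) + total n E * (22 * (n * n))) * Z
      ≡⟨ distribute (σ ^ n) n k (total n E) Z ⟩
    σ ^ n * (22 * n) * (k * Z) + total n E * Z * (22 * (n * n))
      ≤⟨ +-mono-≤ (*-monoʳ-≤ (σ ^ n * (22 * n)) kZ≤n)
           (*-monoˡ-≤ (22 * (n * n)) (total-exceptional m 2≤σ Z mZZ≤ a a′ n k≤n)) ⟩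
    σ ^ n * (22 * n) * n + 5 * σ ^ n * (22 * (n * n))
      -- 132 = 22 * (1 + 5): one share for the fast runs and five for the exceptional strings.
      ≡⟨ collect (σ ^ n) n ⟩
    132 * (n * n) * σ ^ n ∎
    where
    open ≤-Reasoning

    r k : ℕ
    r = σ ^ m * Z
    k = r * m

    E : Vec (Fin σ) n → ℕ
    E = exceptional m a a′ r

    -- `E S` is a natural number, so it is at least 1 on exceptional strings and can serve as the
    -- weight of the worst case.
    pointwise : ∀ S → runningTime S ≤ 22 * (n * k) + E S * (22 * (n * n))
    pointwise S with E S in E≡
    ... | suc e = ≤-trans (runningTime-≤ S) (≤-trans (m≤m+n _ _) (m≤n+m _ (22 * (n * k))))
    ... | zero with unexceptional m S r a≢a′ 1≤m 1≤n 2m≤n k≤n E≡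
    ...   | i , y , i<k , end , none = ≤-trans
            (runningTime-≤-within S k i<k (≤-reflexive end , none)
              (≤-trans (≤-reflexive (trans (sym end) (cong suc (+-comm i y))))
                (+-monoʳ-≤ (suc y) (<⇒≤ i<k))))
            (m≤m+n _ 0)

    distribute : ∀ P n k T Z → (P * (22 * (n * k)) + T * (22 * (n * n))) * Z ≡
      P * (22 * n) * (k * Z) + T * Z * (22 * (n * n))
    distribute = solve-∀

    collect : ∀ P n → P * (22 * n) * n + 5 * P * (22 * (n * n)) ≡ 132 * (n * n) * P
    collect = solve-∀

  /-≤-*-/ : ∀ s c u d e .{{_ : NonZero d}} .{{_ : NonZero e}} → s * e ≤ c * u * d →
    (ℤ.+ s ℚ./ d) ℚ.≤ (ℤ.+ c ℚ./ 1) ℚ.* (ℤ.+ u ℚ./ e)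
  /-≤-*-/ s c u (suc d) (suc e) se≤cud = ℚ.*≤* (subst₂ ℤ._≤_
    -- The denominator of the product on the right is `1 * suc e`, which computes to `suc (e + 0)`.
    (trans (ℤ.pos-* s (suc e)) (cong (λ x → ℤ.+ s ℤ.* ℤ.+ suc x) (sym (+-identityʳ e))))
    (trans (ℤ.pos-* (c * u) (suc d)) (cong (ℤ._* ℤ.+ suc d) (ℤ.pos-* c u)))
    (ℤ.+≤+ se≤cud))

  -- A unary alphabet has no two distinct letters, but there `σ ^ 4` is 1 and the quadratic worst
  -- case is enough.
  average-bound : ∀ σ .{{_ : NonZero σ}} → ∃ λ N → ∀ n → n ≥ N →
    average σ n runningTime ℚ.≤ (ℤ.+ 132 ℚ./ 1) ℚ.* n²/σ⁴ σ n
  average-bound σ@(suc zero) = 0 , λ n _ →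
    /-≤-*-/ (total n runningTime) 132 (n ^ 2) (1 ^ n) 1 {{m^n≢0 1 n}} (unary n)
    where
    open ≤-Reasoning

    unary : ∀ n → total {1} n runningTime * 1 ≤ 132 * (n ^ 2) * 1 ^ n
    unary n = begin
      total {1} n runningTime * 1          ≡⟨ *-identityʳ _ ⟩
      total {1} n runningTime              ≤⟨ ∑-mono (allStrings 1 n) runningTime-≤ ⟩
      total {1} n (λ _ → 22 * (n * n))     ≡⟨ total-const n _ ⟩
      1 ^ n * (22 * (n * n))               ≤⟨ *-monoʳ-≤ (1 ^ n) (*-monoˡ-≤ (n * n) (m≤m+n 22 110)) ⟩
      1 ^ n * (132 * (n * n))              ≡⟨ *-comm (1 ^ n) _ ⟩
      132 * (n * n) * 1 ^ n                ≡⟨ cong (λ x → 132 * (n * x) * 1 ^ n) (*-identityʳ n) ⟨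
      132 * (n ^ 2) * 1 ^ n                ∎
  average-bound σ@(suc (suc _)) = threshold σ (s≤s (s≤s z≤n)) {zero} {suc zero} λ ()
    where
    threshold : ∀ σ .{{_ : NonZero σ}} → 2 ≤ σ → {a a′ : Fin σ} → a ≢ a′ →
      ∃ λ N → ∀ n → n ≥ N →
      average σ n runningTime ℚ.≤ (ℤ.+ 132 ℚ./ 1) ℚ.* n²/σ⁴ σ n
    -- The summands secure `m + m ≤ n` for `m = 12`, `k ≤ n` and `k * Z ≤ n` for `Z = σ ^ 4`.
    threshold σ 2≤σ a≢a′ = 24 + (k + k * σ ^ 4) , λ n n≥N →
      /-≤-*-/ (total n runningTime) 132 (n ^ 2) (σ ^ n) (σ ^ 4) {{m^n≢0 σ n}} {{m^n≢0 σ 4}}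
        (≤-trans (total-runningTime 12 (s≤s z≤n) 2≤σ (σ ^ 4) 12σ⁸≤σ¹² a≢a′ n
            (≤-trans (s≤s z≤n) n≥N)
            (≤-trans (m≤m+n 24 _) n≥N)
            (≤-trans (≤-trans (m≤m+n k _) (m≤n+m _ 24)) n≥N)
            (≤-trans (≤-trans (m≤n+m (k * σ ^ 4) k) (m≤n+m _ 24)) n≥N))
          (≤-reflexive (cong (λ x → 132 * (n * x) * σ ^ n) (sym (*-identityʳ n)))))
      where
      k : ℕ
      k = σ ^ 12 * σ ^ 4 * 12

      12σ⁸≤σ¹² : 12 * (σ ^ 4 * σ ^ 4) ≤ σ ^ 12
      12σ⁸≤σ¹² = begin
        -- `12 ≤ 16 = 2 ^ 4 ≤ σ ^ 4`.
        12 * (σ ^ 4 * σ ^ 4)    ≤⟨ *-monoˡ-≤ (σ ^ 4 * σ ^ 4) (≤-trans (m≤m+n 12 4) (^-monoˡ-≤ 4 2≤σ)) ⟩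
        σ ^ 4 * (σ ^ 4 * σ ^ 4) ≡⟨ cong (σ ^ 4 *_) (^-distribˡ-+-* σ 4 4) ⟨
        σ ^ 4 * σ ^ 8           ≡⟨ ^-distribˡ-+-* σ 4 8 ⟨
        σ ^ 12                  ∎
        where open ≤-Reasoning

  correct : ∀ {σ n} .{{_ : NonZero n}} (S : Vec (Fin σ) n) →
    ∃₂ λ i j → Runs program S (runningTime S) i j × IsMaximalUnborderedFactor S i j
  correct {n = suc n} S = _ , _ , Solves.halts solution , Solves.maximal solution
    where
    solution : Solves S initial (22 * (suc n * suc n))
    solution = solves-always S (s≤s z≤n)

open import Data.Integer.Base using (+_)
open import Data.Rational.Unnormalised.Base using (_≤_; _*_; _/_)

theorem3 : Σ Program λ P →
    Σ ({σ n : ℕ} → Vec (Fin σ) n → ℕ) λ time →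
    Σ ℕ λ C →
    (∀ {σ n} .{{_ : NonZero n}} (S : Vec (Fin σ) n) →
    ∃₂ λ i j → Runs P S (time S) i j × IsMaximalUnborderedFactor S i j)
    × (∀ σ .{{_ : NonZero σ}} → Σ ℕ λ N → ∀ n → n ≥ N →
    average σ n time ≤ (+ C / 1) * n²/σ⁴ σ n)
theorem3 = program , runningTime , 132 , correct , average-bound
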